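{- For every integer $\nu\ge12$, $c_\nu\le\frac14+\frac{1}{3\sqrt\nu-10}$.
   Context: A weighted digraph $D=(V,A,w)$ is a digraph without loops or parallel arcs (opposite arcs allowed) with weights $w:A\to\mathbb{R}_{\ge0}$ (no lower bound on weights); $w(D)$ is the total arc weight. For a partition $(X,Y)$ of $V$, $w(X,Y)$ is the total weight of arcs from $X$ to $Y$, and $\mathrm{mac}(D)=\max_{(X,Y)}w(X,Y)$. For an integer $\nu\ge1$, $c_\nu$ is the supremum of reals $c\ge0$ such that every acyclic weighted digraph $D$ whose longest directed path has exactly $\nu$ vertices satisfies $\mathrm{mac}(D)\ge c\cdot w(D)$. -}

module Defs where

open import Data.Bool.Base using (Bool; T; if_then_else_; _∧_)
open import Data.Fin.Base using (Fin)
open import Data.Fin.Subset using (Subset; inside; outside; ∁)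
open import Data.Integer.Base as ℤ using (+_)
import Data.Integer.Properties as ℤ
open import Data.List.Base using (List; []; _∷_; [_]; _++_; length)
open import Data.List.Relation.Unary.Linked using (Linked)
open import Data.List.Relation.Unary.Unique.Propositional using (Unique)
open import Data.Nat.Base as ℕ using (ℕ; zero; suc; z≤n; s≤s)
import Data.Nat.Properties as ℕ
import Data.Nat.Solver as ℕSolver
open import Data.Product.Base using (∃-syntax; _×_; _,_)
open import Data.Rational.Base as ℚ using (ℚ; 0ℚ; 1ℚ; ½)
import Data.Rational.Properties as ℚ
import Data.Rational.Solver as ℚSolver
open import Data.Rational.Unnormalised.Base as ℚᵘ using (mkℚᵘ)
import Data.Rational.Unnormalised.Properties as ℚᵘ
open import Data.Sum.Base using (inj₁; inj₂)
open import Data.Vec.Base using ([]; _∷_; lookup)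
open import Data.Vec.Functional using (foldr)
open import Function.Base using (_∘_; _$_)
open import Relation.Binary.PropositionalEquality hiding ([_])
open import Relation.Nullary.Negation.Core using (¬_; contradiction)
open import Relation.Nullary.Decidable.Core using (yes; no)

------------------------------------------------------------------------
-- Auxiliary facts about rationals

Cauchy : (ℕ → ℚ) → Set
Cauchy s = ∀ ε → 0ℚ ℚ.< ε →
  ∃[ N ] (∀ m n → N ℕ.≤ m → N ℕ.≤ n → ℚ.∣ s m ℚ.- s n ∣ ℚ.< ε)

module _ where
  open import Data.Rational.Base
  open ℚSolver.+-*-Solver

  ∣-∣-lub : ∀ {p q} → p < q → - p < q → ∣ p ∣ < q
  ∣-∣-lub {p} p<q -p<q with ℚ.∣p∣≡p∨∣p∣≡-p p
  ... | inj₁ eq = subst (_< _) (sym eq) p<q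
  ... | inj₂ eq = subst (_< _) (sym eq) -p<q

  p≤∣p∣ : ∀ p → p ≤ ∣ p ∣
  p≤∣p∣ p with ℚ.≤-total 0ℚ p
  ... | inj₁ 0≤p = ℚ.≤-reflexive (sym (ℚ.0≤p⇒∣p∣≡p 0≤p))
  ... | inj₂ p≤0 = ℚ.≤-trans p≤0 (ℚ.0≤∣p∣ p)

  ∣-∣-swap : ∀ p q → ∣ p - q ∣ ≡ ∣ q - p ∣
  ∣-∣-swap p q = trans (sym (ℚ.∣-p∣≡∣p∣ (p - q)))
    (cong ∣_∣ (solve 2 (λ p q → :- (p :- q) := q :- p) refl p q))

  p-q<r⇒p<q+r : ∀ {p q r} → p - q < r → p < q + r
  p-q<r⇒p<q+r {p} {q} {r} h = subst (_< q + r)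
    (solve 2 (λ p q → q :+ (p :- q) := p) refl p q) (ℚ.+-monoʳ-< q h)

  p<q+r⇒p-q<r : ∀ {p q r} → p < q + r → p - q < r
  p<q+r⇒p-q<r {p} {q} {r} h = subst₂ _<_ (ℚ.+-comm (- q) p)
    (solve 2 (λ q r → :- q :+ (q :+ r) := r) refl q r) (ℚ.+-monoʳ-< (- q) h)

  close⇒upper : ∀ {p q r} → ∣ p - q ∣ < r → p < q + r
  close⇒upper {p} {q} h = p-q<r⇒p<q+r (ℚ.≤-<-trans (p≤∣p∣ (p - q)) h)

  close⇒lower : ∀ {p q r} → ∣ p - q ∣ < r → q < p + r
  close⇒lower {p} {q} h = close⇒upper (subst (_< _) (∣-∣-swap p q) h)

  upper∧lower⇒close : ∀ {p q r} → p < q + r → q < p + r → ∣ p - q ∣ < r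
  upper∧lower⇒close {p} {q} h₁ h₂ = ∣-∣-lub (p<q+r⇒p-q<r h₁)
    (subst (_< _) (solve 2 (λ p q → q :- p := :- (p :- q)) refl p q) (p<q+r⇒p-q<r h₂))

  0<½*p : ∀ {p} → 0ℚ < p → 0ℚ < ½ * p
  0<½*p {p} 0<p = subst (_< ½ * p) (ℚ.*-zeroʳ ½) (ℚ.*-monoʳ-<-pos ½ 0<p)

  ½*p+½*p : ∀ p → ½ * p + ½ * p ≡ p
  ½*p+½*p p = trans (sym (ℚ.*-distribʳ-+ p ½ ½)) (ℚ.*-identityˡ p)

  scale : ∀ K → 0ℚ < K → ∀ ε → 0ℚ < ε → ∃[ δ ] 0ℚ < δ × K * δ ≡ ε
  scale K 0<K ε 0<ε = 1/ K * ε , ℚ.positive⁻¹ _ , (begin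
    K * (1/ K * ε)  ≡⟨ ℚ.*-assoc K (1/ K) ε ⟨
    K * 1/ K * ε    ≡⟨ cong (_* ε) (ℚ.*-inverseʳ K) ⟩
    1ℚ * ε          ≡⟨ ℚ.*-identityˡ ε ⟩
    ε               ∎)
    where
    open ≡-Reasoning
    instance
      K>0 = positive 0<K
      K≢0 = ℚ.pos⇒nonZero K
      ε>0 = positive 0<ε
      1/K>0 = ℚ.1/pos⇒pos K
      1/K*ε>0 = ℚ.pos*pos⇒pos (1/ K) ε

  Cauchy⇒bounded : ∀ s → Cauchy s →
    ∃[ K ] 0ℚ < K × ∃[ N ] (∀ n → N ℕ.≤ n → ∣ s n ∣ ≤ K)
  Cauchy⇒bounded s c with c 1ℚ (ℚ.positive⁻¹ 1ℚ)
  ... | N , close = ∣ s N ∣ + 1ℚ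
                  , ℚ.+-mono-≤-< (ℚ.0≤∣p∣ (s N)) (ℚ.positive⁻¹ 1ℚ)
                  , N
                  , λ n N≤n → begin
    ∣ s n ∣                 ≡⟨ cong ∣_∣ (solve 2 (λ p q → p := q :+ (p :- q)) refl (s n) (s N)) ⟩
    ∣ s N + (s n - s N) ∣   ≤⟨ ℚ.∣p+q∣≤∣p∣+∣q∣ (s N) (s n - s N) ⟩
    ∣ s N ∣ + ∣ s n - s N ∣ ≤⟨ ℚ.+-monoʳ-≤ ∣ s N ∣ (ℚ.<⇒≤ (close n N N≤n ℕ.≤-refl)) ⟩
    ∣ s N ∣ + 1ℚ            ∎
    where open ℚ.≤-Reasoning

  Cauchy-const : ∀ q → Cauchy (λ _ → q)
  Cauchy-const q ε 0<ε = 0 , λ _ _ _ _ →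
    subst (_< ε) (sym (cong ∣_∣ (ℚ.+-inverseʳ q))) 0<ε

  Cauchy-+ : ∀ s t → Cauchy s → Cauchy t → Cauchy (λ n → s n + t n)
  Cauchy-+ s t cs ct ε 0<ε with cs (½ * ε) (0<½*p 0<ε) | ct (½ * ε) (0<½*p 0<ε)
  ... | N₁ , h₁ | N₂ , h₂ = N₁ ℕ.⊔ N₂ , λ m n N≤m N≤n → begin-strict
    ∣ (s m + t m) - (s n + t n) ∣     ≡⟨ cong ∣_∣ (solve 4 (λ a b c d → (a :+ b) :- (c :+ d) := (a :- c) :+ (b :- d)) refl (s m) (t m) (s n) (t n)) ⟩
    ∣ (s m - s n) + (t m - t n) ∣     ≤⟨ ℚ.∣p+q∣≤∣p∣+∣q∣ (s m - s n) (t m - t n) ⟩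
    ∣ s m - s n ∣ + ∣ t m - t n ∣     <⟨ ℚ.+-mono-< (h₁ m n (ℕ.m⊔n≤o⇒m≤o N₁ N₂ N≤m) (ℕ.m⊔n≤o⇒m≤o N₁ N₂ N≤n))
                                                    (h₂ m n (ℕ.m⊔n≤o⇒n≤o N₁ N₂ N≤m) (ℕ.m⊔n≤o⇒n≤o N₁ N₂ N≤n)) ⟩
    ½ * ε + ½ * ε                     ≡⟨ ½*p+½*p ε ⟩
    ε                                 ∎
    where open ℚ.≤-Reasoning

  Cauchy-neg : ∀ s → Cauchy s → Cauchy (λ n → - s n)
  Cauchy-neg s cs ε 0<ε with cs ε 0<ε
  ... | N , h = N , λ m n N≤m N≤n → subst (_< ε)
    (trans (∣-∣-swap (s m) (s n)) (cong ∣_∣ (solve 2 (λ a b → b :- a := :- a :- (:- b)) refl (s m) (s n))))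
    (h m n N≤m N≤n)

  Cauchy-⊔ : ∀ s t → Cauchy s → Cauchy t → Cauchy (λ n → s n ⊔ t n)
  Cauchy-⊔ s t cs ct ε 0<ε with cs ε 0<ε | ct ε 0<ε
  ... | N₁ , h₁ | N₂ , h₂ = N₁ ℕ.⊔ N₂ , λ m n N≤m N≤n →
    let hs = h₁ m n (ℕ.m⊔n≤o⇒m≤o N₁ N₂ N≤m) (ℕ.m⊔n≤o⇒m≤o N₁ N₂ N≤n)
        ht = h₂ m n (ℕ.m⊔n≤o⇒n≤o N₁ N₂ N≤m) (ℕ.m⊔n≤o⇒n≤o N₁ N₂ N≤n)
    in upper∧lower⇒close
         (⊔-step (s m) (t m) (s n) (t n) (close⇒upper {s m} {s n} hs) (close⇒upper {t m} {t n} ht))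
         (⊔-step (s n) (t n) (s m) (t m) (close⇒lower {s m} {s n} hs) (close⇒lower {t m} {t n} ht))
    where
    ⊔-step : ∀ a b c d → a < c + ε → b < d + ε → a ⊔ b < (c ⊔ d) + ε
    ⊔-step a b c d a<c+ε b<d+ε with ℚ.⊔-sel a b
    ... | inj₁ eq = subst (_< (c ⊔ d) + ε) (sym eq) (ℚ.<-≤-trans a<c+ε (ℚ.+-monoˡ-≤ ε (ℚ.p≤p⊔q c d)))
    ... | inj₂ eq = subst (_< (c ⊔ d) + ε) (sym eq) (ℚ.<-≤-trans b<d+ε (ℚ.+-monoˡ-≤ ε (ℚ.p≤q⊔p c d)))

  product-close : ∀ a b c d {K L} → ∣ a ∣ ≤ K → ∣ d ∣ ≤ L →
    ∣ a * b - c * d ∣ ≤ K * ∣ b - d ∣ + L * ∣ a - c ∣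
  product-close a b c d {K} {L} a≤K d≤L = begin
    ∣ a * b - c * d ∣                       ≡⟨ cong ∣_∣ (solve 4 (λ a b c d → a :* b :- c :* d := a :* (b :- d) :+ d :* (a :- c)) refl a b c d) ⟩
    ∣ a * (b - d) + d * (a - c) ∣           ≤⟨ ℚ.∣p+q∣≤∣p∣+∣q∣ (a * (b - d)) (d * (a - c)) ⟩
    ∣ a * (b - d) ∣ + ∣ d * (a - c) ∣       ≡⟨ cong₂ _+_ (ℚ.∣p*q∣≡∣p∣*∣q∣ a (b - d)) (ℚ.∣p*q∣≡∣p∣*∣q∣ d (a - c)) ⟩
    ∣ a ∣ * ∣ b - d ∣ + ∣ d ∣ * ∣ a - c ∣   ≤⟨ ℚ.+-mono-≤
      (ℚ.*-monoʳ-≤-nonNeg ∣ b - d ∣ {{ℚ.∣-∣-nonNeg (b - d)}} a≤K)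
      (ℚ.*-monoʳ-≤-nonNeg ∣ a - c ∣ {{ℚ.∣-∣-nonNeg (a - c)}} d≤L) ⟩
    K * ∣ b - d ∣ + L * ∣ a - c ∣           ∎
    where open ℚ.≤-Reasoning

  Cauchy-* : ∀ s t → Cauchy s → Cauchy t → Cauchy (λ n → s n * t n)
  Cauchy-* s t cs ct ε 0<ε =
    let K , 0<K , N₁ , bs = Cauchy⇒bounded s cs
        L , 0<L , N₂ , bt = Cauchy⇒bounded t ct
        δ , 0<δ , Kδ = scale K 0<K (½ * ε) (0<½*p 0<ε)
        η , 0<η , Lη = scale L 0<L (½ * ε) (0<½*p 0<ε)
        N₃ , h₃ = ct δ 0<δ
        N₄ , h₄ = cs η 0<η
    in N₁ ℕ.⊔ N₂ ℕ.⊔ (N₃ ℕ.⊔ N₄) , λ m n N≤m N≤n →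
      let N₁₂≤m = ℕ.m⊔n≤o⇒m≤o (N₁ ℕ.⊔ N₂) (N₃ ℕ.⊔ N₄) N≤m
          N₁₂≤n = ℕ.m⊔n≤o⇒m≤o (N₁ ℕ.⊔ N₂) (N₃ ℕ.⊔ N₄) N≤n
          N₃₄≤m = ℕ.m⊔n≤o⇒n≤o (N₁ ℕ.⊔ N₂) (N₃ ℕ.⊔ N₄) N≤m
          N₃₄≤n = ℕ.m⊔n≤o⇒n≤o (N₁ ℕ.⊔ N₂) (N₃ ℕ.⊔ N₄) N≤n
      in ℚ.≤-<-trans
        (product-close (s m) (t m) (s n) (t n)
          (bs m (ℕ.m⊔n≤o⇒m≤o N₁ N₂ N₁₂≤m)) (bt n (ℕ.m⊔n≤o⇒n≤o N₁ N₂ N₁₂≤n)))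
        (split-< K L 0<K 0<L Kδ Lη
          (h₃ m n (ℕ.m⊔n≤o⇒m≤o N₃ N₄ N₃₄≤m) (ℕ.m⊔n≤o⇒m≤o N₃ N₄ N₃₄≤n))
          (h₄ m n (ℕ.m⊔n≤o⇒n≤o N₃ N₄ N₃₄≤m) (ℕ.m⊔n≤o⇒n≤o N₃ N₄ N₃₄≤n)))
    where
    split-< : ∀ K L {δ η p q} → 0ℚ < K → 0ℚ < L → K * δ ≡ ½ * ε → L * η ≡ ½ * ε →
              p < δ → q < η → K * p + L * q < ε
    split-< K L {δ} {η} {p} {q} 0<K 0<L Kδ Lη p<δ q<η = begin-strict
      K * p + L * q  <⟨ ℚ.+-mono-< (ℚ.*-monoʳ-<-pos K {{positive 0<K}} p<δ)
                                   (ℚ.*-monoʳ-<-pos L {{positive 0<L}} q<η) ⟩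
      K * δ + L * η  ≡⟨ cong₂ _+_ Kδ Lη ⟩
      ½ * ε + ½ * ε  ≡⟨ ½*p+½*p ε ⟩
      ε              ∎
      where open ℚ.≤-Reasoning

  module _ (ε : ℚ) (0<ε : 0ℚ < ε) where

    ⊔-pos : ∀ p → Positive (p ⊔ ε)
    ⊔-pos p = positive (ℚ.<-≤-trans 0<ε (ℚ.p≤q⊔p p ε))

    1/⊔ : ℚ → ℚ
    1/⊔ p = (1/ (p ⊔ ε)) {{ℚ.pos⇒nonZero (p ⊔ ε) {{⊔-pos p}}}}

    private
      instance
        ε>0 = positive 0<ε
        ε≢0 = ℚ.pos⇒nonZero ε
        1/ε>0 = ℚ.1/pos⇒pos ε

    1/⊔-pos : ∀ p → Positive (1/⊔ p)
    1/⊔-pos p = ℚ.1/pos⇒pos (p ⊔ ε) {{⊔-pos p}}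

    1/⊔-inverse : ∀ p → (p ⊔ ε) * 1/⊔ p ≡ 1ℚ
    1/⊔-inverse p = ℚ.*-inverseʳ (p ⊔ ε) {{ℚ.pos⇒nonZero (p ⊔ ε) {{⊔-pos p}}}}

    1/⊔-upper : ∀ p → 1/⊔ p ≤ 1/ ε
    1/⊔-upper p = begin
      1/⊔ p                     ≡⟨ ℚ.*-identityˡ _ ⟨
      1ℚ * 1/⊔ p                ≡⟨ cong (_* 1/⊔ p) (ℚ.*-inverseʳ ε) ⟨
      ε * 1/ ε * 1/⊔ p          ≡⟨ solve 3 (λ a b c → a :* b :* c := a :* (b :* c)) refl ε (1/ ε) (1/⊔ p) ⟩
      ε * (1/ ε * 1/⊔ p)        ≤⟨ ℚ.*-monoʳ-≤-nonNeg (1/ ε * 1/⊔ p) {{nn}} (ℚ.p≤q⊔p p ε) ⟩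
      (p ⊔ ε) * (1/ ε * 1/⊔ p)  ≡⟨ solve 3 (λ a b c → a :* (b :* c) := (a :* c) :* b) refl (p ⊔ ε) (1/ ε) (1/⊔ p) ⟩
      (p ⊔ ε) * 1/⊔ p * 1/ ε    ≡⟨ cong (_* 1/ ε) (1/⊔-inverse p) ⟩
      1ℚ * 1/ ε                 ≡⟨ ℚ.*-identityˡ _ ⟩
      1/ ε                      ∎
      where
      open ℚ.≤-Reasoning
      nn : NonNegative (1/ ε * 1/⊔ p)
      nn = ℚ.pos⇒nonNeg (1/ ε * 1/⊔ p) {{ℚ.pos*pos⇒pos (1/ ε) (1/⊔ p) {{1/⊔-pos p}}}}

    1/⊔-lipschitz : ∀ p q → ∣ 1/⊔ p - 1/⊔ q ∣ ≤ (1/ ε * 1/ ε) * ∣ (p ⊔ ε) - (q ⊔ ε) ∣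
    1/⊔-lipschitz p q = begin
      ∣ u - v ∣                        ≡⟨ cong ∣_∣ u-v ⟩
      ∣ (u * v) * (b - a) ∣            ≡⟨ ℚ.∣p*q∣≡∣p∣*∣q∣ (u * v) (b - a) ⟩
      ∣ u * v ∣ * ∣ b - a ∣            ≡⟨ cong₂ _*_ (ℚ.0≤p⇒∣p∣≡p (ℚ.nonNegative⁻¹ (u * v) {{nn-uv}})) (∣-∣-swap b a) ⟩
      (u * v) * ∣ a - b ∣              ≤⟨ ℚ.*-monoʳ-≤-nonNeg ∣ a - b ∣ {{nonNegative (ℚ.0≤∣p∣ (a - b))}} uv≤ ⟩
      (1/ ε * 1/ ε) * ∣ a - b ∣        ∎
      where
      open ℚ.≤-Reasoning
      u = 1/⊔ p
      v = 1/⊔ q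
      a = p ⊔ ε
      b = q ⊔ ε
      u-v : u - v ≡ (u * v) * (b - a)
      u-v = sym (begin-equality
        (u * v) * (b - a)        ≡⟨ solve 4 (λ u v a b → (u :* v) :* (b :- a) := u :* (b :* v) :- v :* (a :* u)) refl u v a b ⟩
        u * (b * v) - v * (a * u) ≡⟨ cong₂ (λ x y → u * x - v * y) (1/⊔-inverse q) (1/⊔-inverse p) ⟩
        u * 1ℚ - v * 1ℚ          ≡⟨ cong₂ _-_ (ℚ.*-identityʳ u) (ℚ.*-identityʳ v) ⟩
        u - v ∎)
      nn-uv : NonNegative (u * v)
      nn-uv = ℚ.pos⇒nonNeg (u * v) {{ℚ.pos*pos⇒pos u {{1/⊔-pos p}} v {{1/⊔-pos q}}}}
      uv≤ : u * v ≤ 1/ ε * 1/ ε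
      uv≤ = ℚ.≤-trans
        (ℚ.*-monoʳ-≤-nonNeg v {{ℚ.pos⇒nonNeg v {{1/⊔-pos q}}}} (1/⊔-upper p))
        (ℚ.*-monoˡ-≤-nonNeg (1/ ε) {{ℚ.pos⇒nonNeg (1/ ε)}} (1/⊔-upper q))

    Cauchy-1/⊔ : ∀ s → Cauchy s → Cauchy (λ n → 1/⊔ (s n))
    Cauchy-1/⊔ s cs η 0<η =
      let δ , 0<δ , Kδ = scale K (ℚ.positive⁻¹ K) η 0<η
          N , h = Cauchy-⊔ s (λ _ → ε) cs (Cauchy-const ε) δ 0<δ
      in N , λ m n N≤m N≤n → ℚ.≤-<-trans (1/⊔-lipschitz (s m) (s n))
        (subst (K * ∣ (s m ⊔ ε) - (s n ⊔ ε) ∣ <_) Kδ (ℚ.*-monoʳ-<-pos K (h m n N≤m N≤n)))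
      where
      K = 1/ ε * 1/ ε
      instance
        K>0 : Positive K
        K>0 = ℚ.pos*pos⇒pos (1/ ε) (1/ ε)

------------------------------------------------------------------------
-- Rational approximations to square roots of natural numbers

-- ⌊√n⌋, see isqrt²≤ and <[1+isqrt]².
isqrt : ℕ → ℕ
isqrt zero    = 0
isqrt (suc n) = let r = isqrt n in
  if suc r ℕ.* suc r ℕ.≤ᵇ suc n then suc r else r

module _ where
  open import Data.Nat.Base
  open ℕSolver.+-*-Solver

  isqrt²≤ : ∀ n → isqrt n * isqrt n ≤ n
  isqrt²≤ zero = z≤n
  isqrt²≤ (suc n) with suc (isqrt n) * suc (isqrt n) ≤ᵇ suc n in eq
  ... | Bool.true  = ℕ.≤ᵇ⇒≤ _ _ (subst T (sym eq) _)
  ... | Bool.false = ℕ.m≤n⇒m≤1+n (isqrt²≤ n)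

  <[1+isqrt]² : ∀ n → n < suc (isqrt n) * suc (isqrt n)
  <[1+isqrt]² zero = s≤s z≤n
  <[1+isqrt]² (suc n) with suc (isqrt n) * suc (isqrt n) ≤ᵇ suc n in eq
  ... | Bool.false = ℕ.≰⇒> λ le → subst T eq (ℕ.≤⇒≤ᵇ le)
  ... | Bool.true  = ℕ.≤-<-trans (<[1+isqrt]² n)
    (ℕ.*-mono-< {suc (isqrt n)} {suc (suc (isqrt n))} ℕ.≤-refl ℕ.≤-refl)

  square-cancel-< : ∀ {m n} → m * m < n * n → m < n
  square-cancel-< {m} {n} h with m ℕ.<? n
  ... | yes m<n = m<n
  ... | no  m≮n = contradiction h (ℕ.≤⇒≯ (ℕ.*-mono-≤ (ℕ.≮⇒≥ m≮n) (ℕ.≮⇒≥ m≮n)))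

  √num : ℕ → ℕ → ℕ
  √num ν n = isqrt (ν * (suc n * suc n))

  √num-cross : ∀ ν m n → √num ν m * suc n < suc (√num ν n) * suc m
  √num-cross ν m n = square-cancel-< (begin-strict
    (a * N) * (a * N)                ≡⟨ solve 2 (λ a N → (a :* N) :* (a :* N) := (a :* a) :* (N :* N)) refl a N ⟩
    (a * a) * (N * N)                ≤⟨ ℕ.*-monoˡ-≤ (N * N) (isqrt²≤ (ν * (M * M))) ⟩
    ν * (M * M) * (N * N)            ≡⟨ solve 3 (λ ν M N → ν :* M :* N := ν :* N :* M) refl ν (M * M) (N * N) ⟩
    ν * (N * N) * (M * M)            <⟨ ℕ.*-monoˡ-< (M * M) (<[1+isqrt]² (ν * (N * N))) ⟩
    (suc b * suc b) * (M * M)        ≡⟨ solve 2 (λ b M → (b :* b) :* (M :* M) := (b :* M) :* (b :* M)) refl (suc b) M ⟩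
    (suc b * M) * (suc b * M)        ∎)
    where
    open ℕ.≤-Reasoning
    M = suc m
    N = suc n
    a = √num ν m
    b = √num ν n

  √num-lower : ∀ ν n → 12 ≤ ν → 13 ≤ suc n → 17 * suc n ≤ 5 * √num ν n
  √num-lower ν n 12≤ν 13≤M = ℕ.≮⇒≥ λ 5a<17M → ℕ.<-irrefl refl (begin-strict
    25 * (12 * (M * M))                    ≤⟨ ℕ.*-monoʳ-≤ 25 (ℕ.*-monoˡ-≤ (M * M) 12≤ν) ⟩
    25 * (ν * (M * M))                     <⟨ ℕ.*-monoʳ-< 25 (<[1+isqrt]² (ν * (M * M))) ⟩
    25 * (suc a * suc a)                   ≡⟨ solve 1 (λ a → con 25 :* ((con 1 :+ a) :* (con 1 :+ a)) := (con 1 :+ con 5 :* a :+ con 4) :* (con 1 :+ con 5 :* a :+ con 4)) refl a ⟩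
    (suc (5 * a) + 4) * (suc (5 * a) + 4)  ≤⟨ ℕ.*-mono-≤ (ℕ.+-monoˡ-≤ 4 5a<17M) (ℕ.+-monoˡ-≤ 4 5a<17M) ⟩
    (17 * M + 4) * (17 * M + 4)            ≡⟨ solve 1 (λ M → (con 17 :* M :+ con 4) :* (con 17 :* M :+ con 4) := con 289 :* (M :* M) :+ (con 136 :* M :+ con 16)) refl M ⟩
    289 * (M * M) + (136 * M + 16)         ≤⟨ ℕ.+-monoʳ-≤ (289 * (M * M)) (ℕ.+-monoʳ-≤ (136 * M) 16≤7M) ⟩
    289 * (M * M) + (136 * M + 7 * M)      ≡⟨ solve 1 (λ M → con 289 :* (M :* M) :+ (con 136 :* M :+ con 7 :* M) := con 289 :* (M :* M) :+ con 11 :* (con 13 :* M)) refl M ⟩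
    289 * (M * M) + 11 * (13 * M)          ≤⟨ ℕ.+-monoʳ-≤ (289 * (M * M)) (ℕ.*-monoʳ-≤ 11 (ℕ.*-monoˡ-≤ M 13≤M)) ⟩
    289 * (M * M) + 11 * (M * M)           ≡⟨ solve 1 (λ M → con 289 :* (M :* M) :+ con 11 :* (M :* M) := con 25 :* (con 12 :* (M :* M))) refl M ⟩
    25 * (12 * (M * M))                    ∎)
    where
    open ℕ.≤-Reasoning
    M = suc n
    a = √num ν n
    16≤7M : 16 ≤ 7 * M
    16≤7M = ℕ.≤-trans (ℕ.m≤m+n 16 75) (ℕ.*-monoʳ-≤ 7 13≤M)

module _ where
  open import Data.Rational.Base

  toℚᵘ-/ : ∀ i n → toℚᵘ (i / suc n) ℚᵘ.≃ mkℚᵘ i n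
  toℚᵘ-/ i n = ℚ.toℚᵘ-fromℚᵘ (mkℚᵘ i n)

  /-cross-< : ∀ a m b n → a ℕ.* suc n ℕ.< b ℕ.* suc m → + a / suc m < + b / suc n
  /-cross-< a m b n h = ℚ.toℚᵘ-cancel-< $
    ℚᵘ.<-respˡ-≃ (ℚᵘ.≃-sym (toℚᵘ-/ (+ a) m)) $
    ℚᵘ.<-respʳ-≃ (ℚᵘ.≃-sym (toℚᵘ-/ (+ b) n)) $
    ℚᵘ.*<* (subst₂ ℤ._<_ (ℤ.pos-* a (suc n)) (ℤ.pos-* b (suc m)) (ℤ.+<+ h))

  /-cross-≤ : ∀ a m b n → a ℕ.* suc n ℕ.≤ b ℕ.* suc m → + a / suc m ≤ + b / suc n
  /-cross-≤ a m b n h = ℚ.toℚᵘ-cancel-≤ $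
    ℚᵘ.≤-respˡ-≃ (ℚᵘ.≃-sym (toℚᵘ-/ (+ a) m)) $
    ℚᵘ.≤-respʳ-≃ (ℚᵘ.≃-sym (toℚᵘ-/ (+ b) n)) $
    ℚᵘ.*≤* (subst₂ ℤ._≤_ (ℤ.pos-* a (suc n)) (ℤ.pos-* b (suc m)) (ℤ.+≤+ h))

  suc-/ : ∀ b n → + suc b / suc n ≡ + b / suc n + + 1 / suc n
  suc-/ b n = ℚ.toℚᵘ-injective $ begin
    toℚᵘ (+ suc b / suc n)                      ≈⟨ toℚᵘ-/ (+ suc b) n ⟩
    mkℚᵘ (+ suc b) n                            ≈⟨ ℚᵘ.*≡* eq ⟩
    mkℚᵘ (+ b) n ℚᵘ.+ mkℚᵘ (+ 1) n              ≈⟨ ℚᵘ.+-cong (toℚᵘ-/ (+ b) n) (toℚᵘ-/ (+ 1) n) ⟨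
    toℚᵘ (+ b / suc n) ℚᵘ.+ toℚᵘ (+ 1 / suc n)  ≈⟨ ℚ.toℚᵘ-homo-+ (+ b / suc n) (+ 1 / suc n) ⟨
    toℚᵘ (+ b / suc n + + 1 / suc n)            ∎
    where
    open ℚᵘ.≃-Reasoning
    open import Data.Integer.Solver using (module +-*-Solver)
    open +-*-Solver
    eq : + suc b ℤ.* + (suc n ℕ.* suc n) ≡ (+ b ℤ.* + suc n ℤ.+ + 1 ℤ.* + suc n) ℤ.* + suc n
    eq = trans (cong (+ suc b ℤ.*_) (ℤ.pos-* (suc n) (suc n)))
      (solve 2 (λ b N → (con (+ 1) :+ b) :* (N :* N) := (b :* N :+ con (+ 1) :* N) :* N) refl (+ b) (+ suc n))

  archimedean : ∀ ε → 0ℚ < ε → ∃[ N ] (∀ n → N ℕ.≤ n → + 1 / suc n < ε)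
  archimedean ε@(mkℚ (+ suc p) d _) 0<ε = suc d , λ n d<n →
    subst (+ 1 / suc n <_) (ℚ.↥p/↧p≡p ε)
      (/-cross-< 1 n (suc p) d (begin-strict
        1 ℕ.* suc d    ≡⟨ ℕ.*-identityˡ _ ⟩
        suc d          ≤⟨ d<n ⟩
        n              <⟨ ℕ.n<1+n n ⟩
        suc n          ≤⟨ ℕ.m≤m+n (suc n) (p ℕ.* suc n) ⟩
        suc p ℕ.* suc n ∎))
    where open ℕ.≤-Reasoning
  archimedean (mkℚ (+ zero)   _ _) (*<* (ℤ.+<+ ()))
  archimedean (mkℚ (ℤ.-[1+ _ ]) _ _) (*<* ())

-- ⌊√(ν (n+1)²)⌋ / (n+1), which lies in (√ν - 1/(n+1), √ν]
√seq : ℕ → ℕ → ℚ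
√seq ν n = + √num ν n ℚ./ suc n

√seq-close : ∀ ν m n → √seq ν m ℚ.< √seq ν n ℚ.+ + 1 ℚ./ suc n
√seq-close ν m n = subst (√seq ν m ℚ.<_) (suc-/ (√num ν n) n)
  (/-cross-< (√num ν m) m (suc (√num ν n)) n (√num-cross ν m n))

------------------------------------------------------------------------
-- Real numbers: Cauchy sequences of rationals, with the arithmetic
-- operations taken termwise.  Two sequences represent the same real
-- number when x ≤ y and y ≤ x.

record ℝ : Set where
  constructor mkℝ
  field
    seq    : ℕ → ℚ
    cauchy : Cauchy seq

open ℝ public

infix 4 _≤_ _<_
infixl 7 _*_
infixl 6 _+_ _-_ _⊔_
infix 8 -_

_≤_ : ℝ → ℝ → Set
x ≤ y = ∀ ε → 0ℚ ℚ.< ε → ∃[ N ] (∀ n → N ℕ.≤ n → seq x n ℚ.≤ seq y n ℚ.+ ε)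

_<_ : ℝ → ℝ → Set
x < y = ∃[ ε ] 0ℚ ℚ.< ε × ∃[ N ] (∀ n → N ℕ.≤ n → seq x n ℚ.+ ε ℚ.≤ seq y n)

fromℚ : ℚ → ℝ
fromℚ q = mkℝ (λ _ → q) (Cauchy-const q)

fromℕ : ℕ → ℝ
fromℕ n = fromℚ (+ n ℚ./ 1)

_+_ : ℝ → ℝ → ℝ
x + y = mkℝ (λ n → seq x n ℚ.+ seq y n) (Cauchy-+ (seq x) (seq y) (cauchy x) (cauchy y))

-_ : ℝ → ℝ
- x = mkℝ (λ n → ℚ.- seq x n) (Cauchy-neg (seq x) (cauchy x))

_-_ : ℝ → ℝ → ℝ
x - y = x + (- y)

_*_ : ℝ → ℝ → ℝ
x * y = mkℝ (λ n → seq x n ℚ.* seq y n) (Cauchy-* (seq x) (seq y) (cauchy x) (cauchy y))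

_⊔_ : ℝ → ℝ → ℝ
x ⊔ y = mkℝ (λ n → seq x n ℚ.⊔ seq y n) (Cauchy-⊔ (seq x) (seq y) (cauchy x) (cauchy y))

-- A proof of 0 < x provides an ε > 0 with ε ≤ xₙ for all large n, so
-- 1/(xₙ ⊔ ε) equals 1/xₙ for all large n.
recip : (x : ℝ) → fromℚ 0ℚ < x → ℝ
recip x (ε , 0<ε , _) = mkℝ (λ n → 1/⊔ ε 0<ε (seq x n)) (Cauchy-1/⊔ ε 0<ε (seq x) (cauchy x))

√_ : ℕ → ℝ
√ ν = mkℝ (√seq ν) λ ε 0<ε → let N , small = archimedean ε 0<ε in
  N , λ m n N≤m N≤n → upper∧lower⇒close
    (ℚ.<-trans (√seq-close ν m n) (ℚ.+-monoʳ-< (√seq ν n) (small n N≤n)))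
    (ℚ.<-trans (√seq-close ν n m) (ℚ.+-monoʳ-< (√seq ν m) (small m N≤m)))

0<3√ν-10 : ∀ {ν} → 12 ℕ.≤ ν → fromℚ 0ℚ < fromℕ 3 * √ ν - fromℕ 10
0<3√ν-10 {ν} 12≤ν = + 1 ℚ./ 5 , ℚ.positive⁻¹ _ , 12 , λ n 12≤n →
  ℚ.+-monoˡ-≤ (ℚ.- (+ 10 ℚ./ 1)) (ℚ.*-monoˡ-≤-nonNeg (+ 3 ℚ./ 1)
    (/-cross-≤ 17 4 (√num ν n) n
      (subst (17 ℕ.* suc n ℕ.≤_) (ℕ.*-comm 5 (√num ν n)) (√num-lower ν n 12≤ν (s≤s 12≤n)))))

------------------------------------------------------------------------
-- Suprema of sets of reals

-- A Dedekind lower cut.  A set of Cauchy reals that is nonempty and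
-- bounded above need not constructively have a Cauchy real as its
-- supremum, but its supremum always exists as a lower cut, namely as
-- the union of the lower cuts of its elements.
LowerCut : Set₁
LowerCut = ℚ → Set

↓_ : ℝ → LowerCut
(↓ x) q = fromℚ q < x

sup : (ℝ → Set) → LowerCut
sup S q = ∃[ x ] S x × (↓ x) q

infix 4 _≤ᶜ_

_≤ᶜ_ : LowerCut → LowerCut → Set
L ≤ᶜ M = ∀ q → L q → M q

------------------------------------------------------------------------
-- Weighted digraphs

∑ : ∀ {n} → (Fin n → ℝ) → ℝ
∑ = foldr _+_ (fromℚ 0ℚ)

-- Only the values of weight on arcs are relevant.
record WeightedDigraph : Set where
  field
    order     : ℕ
    arc       : Fin order → Fin order → Bool
    loopless  : ∀ v → ¬ T (arc v v)
    weight    : Fin order → Fin order → ℝ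
    weight-≥0 : ∀ u v → T (arc u v) → fromℚ 0ℚ ≤ weight u v

module _ (D : WeightedDigraph) where
  open WeightedDigraph D

  Vertex : Set
  Vertex = Fin order

  _⟶_ : Vertex → Vertex → Set
  u ⟶ v = T (arc u v)

  IsPath : List Vertex → Set
  IsPath p = Linked _⟶_ p × Unique p

  -- The cycle v, v₁, …, vₖ, v
  IsCycle : Vertex → List Vertex → Set
  IsCycle v vs = Linked _⟶_ (v ∷ vs ++ [ v ]) × Unique (v ∷ vs)

  Acyclic : Set
  Acyclic = ∀ v vs → ¬ IsCycle v vs

  LongestPathOrder : ℕ → Set
  LongestPathOrder ν =
    (∃[ p ] IsPath p × length p ≡ ν) × (∀ p → IsPath p → length p ℕ.≤ ν)

  totalWeight : ℝ
  totalWeight = ∑ λ u → ∑ λ v → if arc u v then weight u v else fromℚ 0ℚ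

  weightBetween : Subset order → Subset order → ℝ
  weightBetween X Y = ∑ λ u → ∑ λ v →
    if lookup X u ∧ lookup Y v ∧ arc u v then weight u v else fromℚ 0ℚ

maxOverSubsets : ∀ {n} → (Subset n → ℝ) → ℝ
maxOverSubsets {zero}  f = f []
maxOverSubsets {suc n} f =
  maxOverSubsets (f ∘ (inside ∷_)) ⊔ maxOverSubsets (f ∘ (outside ∷_))

mac : WeightedDigraph → ℝ
mac D = maxOverSubsets λ X → weightBetween D X (∁ X)

Admissible : ℕ → ℝ → Set
Admissible ν c = fromℚ 0ℚ ≤ c ×
  (∀ D → Acyclic D → LongestPathOrder D ν → c * totalWeight D ≤ mac D)

c : ℕ → LowerCut
c ν = sup (Admissible ν)

{-# OPTIONS --safe #-}
module Submission where

-- Put the weight mᵤ mᵥ ρ^(v - u) on the arcs u < v of a transitive tournament.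
-- Adding vertices at the front, a cut evolves through a single number p, the
-- discounted mass of its sinks, and 2ρ(1-ρ²) cut + (1-ρ²) p² grows by at most
-- ρ² m² with every vertex of mass m.  Hence cut ≤ ρ ∑ m² / (2(1-ρ²)).  With
-- r = ⌊√ν⌋ and ρ = 1 - 1/r, the masses are chosen such that the discounted mass
-- of all later vertices grows linearly over 3r vertices and is constant from
-- then on.  Constant masses alone would give only 1/4 + 1/√(8ν) to leading
-- order; the ramp reduces the loss at the boundary enough to reach
-- 1/4 + 1/(3r-7), and 3√ν - 10 ≤ 3r - 7.

open import Algebra.Bundles using (CommutativeRing)
import Algebra.Properties.Semiring.Sum
open import Defs
open import Data.Bool.Base using (Bool; true; false; T; if_then_else_; _∧_)
open import Data.Bool.Properties using (∧-identityʳ)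
open import Data.Fin.Base using (Fin; zero; suc; toℕ)
open import Data.Fin.Properties using (toℕ<n)
open import Data.Fin.Subset using (Subset; inside; outside; ∁)
open import Data.Integer.Base as ℤ using (+_)
import Data.Integer.Properties as ℤ
open import Data.List.Base as List using ([]; _∷_; allFin)
open import Data.List.Properties using (length-tabulate)
open import Data.List.Relation.Unary.All using ([]; _∷_)
open import Data.List.Relation.Unary.All.Properties using (++⁻ʳ)
open import Data.List.Relation.Unary.AllPairs using (_∷_)
open import Data.List.Relation.Unary.AllPairs.Properties using (tabulate⁺-<)
open import Data.List.Relation.Unary.Linked using (Linked; [-]; _∷_)
open import Data.List.Relation.Unary.Linked.Properties
  using (AllPairs⇒Linked; Linked⇒AllPairs)
open import Data.List.Relation.Unary.Unique.Propositional.Properties using (allFin⁺)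
open import Data.Nat.Base as ℕ using (ℕ; zero; suc; z≤n; s≤s)
import Data.Nat.Properties as ℕ
import Data.Nat.Solver as ℕSolver
open import Data.Product.Base using (_,_; proj₁; proj₂)
open import Data.Rational.Base as ℚ using (ℚ; 0ℚ; 1ℚ; ½)
import Data.Rational.Properties as ℚ
import Data.Rational.Solver as ℚSolver
import Data.Rational.Unnormalised.Base as ℚᵘ
import Data.Rational.Unnormalised.Properties as ℚᵘ
open import Data.Sum.Base using (inj₁; inj₂)
open import Data.Vec.Base using ([]; _∷_; lookup)
open import Function.Base using (_∘_; _$_; id)
open import Relation.Binary.PropositionalEquality
open import Relation.Nullary.Negation.Core using (contradiction)

open Algebra.Properties.Semiring.Sum (CommutativeRing.semiring ℚ.+-*-commutativeRing)
  using (sum; sum-cong-≗; sum-replicate-zero; *-distribˡ-sum)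

-- Nonnegative rationals and the embedding of ℕ into ℚ

0≤p*p : ∀ p → 0ℚ ℚ.≤ p ℚ.* p
0≤p*p p = subst (0ℚ ℚ.≤_) (abs² p) (ℚ.nonNegative⁻¹ _
  {{ℚ.nonNeg*nonNeg⇒nonNeg ℚ.∣ p ∣ {{ℚ.∣-∣-nonNeg p}} ℚ.∣ p ∣ {{ℚ.∣-∣-nonNeg p}}}})
  where
  open ℚSolver.+-*-Solver
  abs² : ∀ p → ℚ.∣ p ∣ ℚ.* ℚ.∣ p ∣ ≡ p ℚ.* p
  abs² p with ℚ.∣p∣≡p∨∣p∣≡-p p
  ... | inj₁ eq = cong₂ ℚ._*_ eq eq
  ... | inj₂ eq = trans (cong₂ ℚ._*_ eq eq) (solve 1 (λ p → :- p :* :- p := p :* p) refl p)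

0≤*0≤ : ∀ {p q} → 0ℚ ℚ.≤ p → 0ℚ ℚ.≤ q → 0ℚ ℚ.≤ p ℚ.* q
0≤*0≤ {p} {q} 0≤p 0≤q = ℚ.nonNegative⁻¹ _
  {{ℚ.nonNeg*nonNeg⇒nonNeg p {{ℚ.nonNegative 0≤p}} q {{ℚ.nonNegative 0≤q}}}}

p≤p+q*q : ∀ p q → p ℚ.≤ p ℚ.+ q ℚ.* q
p≤p+q*q p q = subst (ℚ._≤ p ℚ.+ q ℚ.* q) (ℚ.+-identityʳ p) (ℚ.+-monoʳ-≤ p (0≤p*p q))

fromℕℚ : ℕ → ℚ
fromℕℚ n = + n ℚ./ 1

fromℕℚ-+ : ∀ m n → fromℕℚ (m ℕ.+ n) ≡ fromℕℚ m ℚ.+ fromℕℚ n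
fromℕℚ-+ m n = ℚ.toℚᵘ-injective $ begin
  ℚ.toℚᵘ (fromℕℚ (m ℕ.+ n))                        ≈⟨ toℚᵘ-/ (+ (m ℕ.+ n)) 0 ⟩
  ℚᵘ.mkℚᵘ (+ (m ℕ.+ n)) 0                          ≈⟨ ℚᵘ.*≡* (cong (ℤ._* + 1) (sym
    (cong₂ ℤ._+_ (ℤ.*-identityʳ (+ m)) (ℤ.*-identityʳ (+ n))))) ⟩
  ℚᵘ.mkℚᵘ (+ m) 0 ℚᵘ.+ ℚᵘ.mkℚᵘ (+ n) 0             ≈⟨ ℚᵘ.+-cong (toℚᵘ-/ (+ m) 0) (toℚᵘ-/ (+ n) 0) ⟨
  ℚ.toℚᵘ (fromℕℚ m) ℚᵘ.+ ℚ.toℚᵘ (fromℕℚ n)         ≈⟨ ℚ.toℚᵘ-homo-+ (fromℕℚ m) (fromℕℚ n) ⟨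
  ℚ.toℚᵘ (fromℕℚ m ℚ.+ fromℕℚ n)                   ∎
  where open ℚᵘ.≃-Reasoning

fromℕℚ-* : ∀ m n → fromℕℚ (m ℕ.* n) ≡ fromℕℚ m ℚ.* fromℕℚ n
fromℕℚ-* m n = ℚ.toℚᵘ-injective $ begin
  ℚ.toℚᵘ (fromℕℚ (m ℕ.* n))                        ≈⟨ toℚᵘ-/ (+ (m ℕ.* n)) 0 ⟩
  ℚᵘ.mkℚᵘ (+ (m ℕ.* n)) 0                          ≈⟨ ℚᵘ.*≡* (cong (ℤ._* + 1) (ℤ.pos-* m n)) ⟩
  ℚᵘ.mkℚᵘ (+ m) 0 ℚᵘ.* ℚᵘ.mkℚᵘ (+ n) 0             ≈⟨ ℚᵘ.*-cong (toℚᵘ-/ (+ m) 0) (toℚᵘ-/ (+ n) 0) ⟨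
  ℚ.toℚᵘ (fromℕℚ m) ℚᵘ.* ℚ.toℚᵘ (fromℕℚ n)         ≈⟨ ℚ.toℚᵘ-homo-* (fromℕℚ m) (fromℕℚ n) ⟨
  ℚ.toℚᵘ (fromℕℚ m ℚ.* fromℕℚ n)                   ∎
  where open ℚᵘ.≃-Reasoning

fromℕℚ-mono-≤ : ∀ {m n} → m ℕ.≤ n → fromℕℚ m ℚ.≤ fromℕℚ n
fromℕℚ-mono-≤ {m} {n} m≤n = /-cross-≤ m 0 n 0 (ℕ.*-monoˡ-≤ 1 m≤n)

0≤fromℕℚ : ∀ n → 0ℚ ℚ.≤ fromℕℚ n
0≤fromℕℚ n = fromℕℚ-mono-≤ (z≤n {n})

fromℕℚ-suc-pos : ∀ n → ℚ.Positive (fromℕℚ (suc n))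
fromℕℚ-suc-pos n = ℚ.positive (/-cross-< 0 0 (suc n) 0 (s≤s z≤n))

-- Real sums and maxima, evaluated termwise

seq-∑ : ∀ {n} (f : Fin n → ℝ) i → seq (∑ f) i ≡ sum (λ u → seq (f u) i)
seq-∑ {zero}  f i = refl
seq-∑ {suc n} f i = cong (seq (f zero) i ℚ.+_) (seq-∑ (f ∘ suc) i)

seq-if : ∀ b q i →
  seq (if b then fromℚ q else fromℚ 0ℚ) i ≡ (if b then q else 0ℚ)
seq-if true  q i = refl
seq-if false q i = refl

seq-∑∑-if : ∀ {n} (b : Fin n → Fin n → Bool) (w : Fin n → Fin n → ℚ) i →
  seq (∑ λ u → ∑ λ v → if b u v then fromℚ (w u v) else fromℚ 0ℚ) i ≡
  sum (λ u → sum λ v → if b u v then w u v else 0ℚ)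
seq-∑∑-if b w i = trans (seq-∑ (λ u → ∑ λ v → if b u v then fromℚ (w u v) else fromℚ 0ℚ) i)
  (sum-cong-≗ λ u → trans (seq-∑ (λ v → if b u v then fromℚ (w u v) else fromℚ 0ℚ) i)
    (sum-cong-≗ λ v → seq-if (b u v) (w u v) i))

-- At every index the maximum of two terms is one of them, so the value is attained by some subset.
maxOverSubsets-elim : ∀ {n} (P : ℚ → Set) (f : Subset n → ℝ) i →
  (∀ X → P (seq (f X) i)) → P (seq (maxOverSubsets f) i)
maxOverSubsets-elim {zero}  P f i Pf = Pf []
maxOverSubsets-elim {suc n} P f i Pf
  with ℚ.⊔-sel (seq (maxOverSubsets (f ∘ (inside ∷_))) i) (seq (maxOverSubsets (f ∘ (outside ∷_))) i)
... | inj₁ eq = subst P (sym eq) (maxOverSubsets-elim P (f ∘ (inside ∷_)) i (λ X → Pf (inside ∷ X)))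
... | inj₂ eq = subst P (sym eq) (maxOverSubsets-elim P (f ∘ (outside ∷_)) i (λ X → Pf (outside ∷ X)))

-- Transitive tournaments

_<ᶠ_ : ∀ {n} → Fin n → Fin n → Bool
u <ᶠ v = toℕ u ℕ.<ᵇ toℕ v

<ᶠ-trans : ∀ {n} {u v x : Fin n} → T (u <ᶠ v) → T (v <ᶠ x) → T (u <ᶠ x)
<ᶠ-trans {_} {u} {v} {x} u<v v<x = ℕ.<⇒<ᵇ (ℕ.<-trans
  (ℕ.<ᵇ⇒< (toℕ u) (toℕ v) u<v) (ℕ.<ᵇ⇒< (toℕ v) (toℕ x) v<x))

-- Each arc raises the label by at least one and labels stay below `n`. This bounds the length of
-- every path in the tournament.
increasing-length : ∀ {n} (v : Fin n) vs → Linked (λ x y → T (x <ᶠ y)) (v ∷ vs) →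
  toℕ v ℕ.+ List.length (v ∷ vs) ℕ.≤ n
increasing-length {n} v [] [-] = subst (ℕ._≤ n) (ℕ.+-comm 1 (toℕ v)) (toℕ<n v)
increasing-length {n} v (x ∷ vs) (v<x ∷ linked) = begin
  toℕ v ℕ.+ suc (List.length (x ∷ vs))  ≡⟨ ℕ.+-suc (toℕ v) _ ⟩
  suc (toℕ v) ℕ.+ List.length (x ∷ vs)  ≤⟨ ℕ.+-monoˡ-≤ _ (ℕ.<ᵇ⇒< (toℕ v) (toℕ x) v<x) ⟩
  toℕ x ℕ.+ List.length (x ∷ vs)        ≤⟨ increasing-length x vs linked ⟩
  n                                     ∎
  where open ℕ.≤-Reasoning

transitiveTournament : ∀ n (w : Fin n → Fin n → ℚ) → (∀ u v → 0ℚ ℚ.≤ w u v) → WeightedDigraph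
transitiveTournament n w 0≤w = record
  { order     = n
  ; arc       = _<ᶠ_
  ; loopless  = λ v v<v → ℕ.<-irrefl refl (ℕ.<ᵇ⇒< (toℕ v) (toℕ v) v<v)
  ; weight    = λ u v → fromℚ (w u v)
  ; weight-≥0 = λ u v _ ε 0<ε → 0 , λ _ _ →
      ℚ.≤-trans (0≤w u v) (ℚ.≤-trans (ℚ.≤-reflexive (sym (ℚ.+-identityʳ (w u v))))
        (ℚ.+-monoʳ-≤ (w u v) (ℚ.<⇒≤ 0<ε)))
  }

module _ (n : ℕ) (w : Fin n → Fin n → ℚ) (0≤w : ∀ u v → 0ℚ ℚ.≤ w u v) where

  transitiveTournament-acyclic : Acyclic (transitiveTournament n w 0≤w)
  transitiveTournament-acyclic v vs (linked , _)
    -- By transitivity the initial `v` precedes every later entry of the cycle, including the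
    -- closing `v`.
    with Linked⇒AllPairs (λ {x} {y} {z} → <ᶠ-trans {n} {x} {y} {z}) linked
  ... | v< ∷ _ with ++⁻ʳ vs v<
  ... | v<v ∷ [] = ℕ.<-irrefl refl (ℕ.<ᵇ⇒< (toℕ v) (toℕ v) v<v)

  transitiveTournament-longestPathOrder : LongestPathOrder (transitiveTournament n w 0≤w) n
  transitiveTournament-longestPathOrder =
    (allFin n , (AllPairs⇒Linked (tabulate⁺-< ℕ.<⇒<ᵇ) , allFin⁺ n) , length-tabulate id) ,
    λ { []       _            → z≤n
      ; (v ∷ vs) (linked , _) → ℕ.≤-trans (ℕ.m≤n+m _ (toℕ v)) (increasing-length v vs linked) }

-- Geometrically decaying weights

-- The vertex with ℓ vertices after it has mass m ℓ, and the arc from u to v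
-- has weight (mass of u) ρ^(v - u) (mass of v); pull n v is ρ^(v + 1) (mass of v).
module Geometric (ρ : ℚ) (0≤ρ : 0ℚ ℚ.≤ ρ) (m : ℕ → ℚ) (0≤m : ∀ ℓ → 0ℚ ℚ.≤ m ℓ) where

  pull : ∀ n → Fin n → ℚ
  pull (suc n) zero    = ρ ℚ.* m n
  pull (suc n) (suc v) = ρ ℚ.* pull n v

  geometricWeight : ∀ n → Fin n → Fin n → ℚ
  geometricWeight (suc n) zero    zero    = 0ℚ
  geometricWeight (suc n) zero    (suc v) = m n ℚ.* pull n v
  geometricWeight (suc n) (suc u) zero    = 0ℚ
  geometricWeight (suc n) (suc u) (suc v) = geometricWeight n u v

  0≤pull : ∀ n v → 0ℚ ℚ.≤ pull n v
  0≤pull (suc n) zero    = 0≤*0≤ 0≤ρ (0≤m n)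
  0≤pull (suc n) (suc v) = 0≤*0≤ 0≤ρ (0≤pull n v)

  0≤geometricWeight : ∀ n u v → 0ℚ ℚ.≤ geometricWeight n u v
  0≤geometricWeight (suc n) zero    zero    = ℚ.≤-refl
  0≤geometricWeight (suc n) zero    (suc v) = 0≤*0≤ (0≤m n) (0≤pull n v)
  0≤geometricWeight (suc n) (suc u) zero    = ℚ.≤-refl
  0≤geometricWeight (suc n) (suc u) (suc v) = 0≤geometricWeight n u v

  geometricTournament : ℕ → WeightedDigraph
  geometricTournament n = transitiveTournament n (geometricWeight n) (0≤geometricWeight n)

  pullOf : ∀ n → (Fin n → Bool) → ℚ
  pullOf n b = sum λ v → if b v then pull n v else 0ℚ

  weightOf : ∀ n → (Fin n → Fin n → Bool) → ℚ
  weightOf n b = sum λ u → sum λ v → if b u v then geometricWeight n u v else 0ℚ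

  *-if : ∀ x b y → (if b then x ℚ.* y else 0ℚ) ≡ x ℚ.* (if b then y else 0ℚ)
  *-if x true  y = refl
  *-if x false y = sym (ℚ.*-zeroʳ x)

  sum-if-* : ∀ {n} x (b : Fin n → Bool) (y : Fin n → ℚ) →
    sum (λ v → if b v then x ℚ.* y v else 0ℚ) ≡ x ℚ.* sum (λ v → if b v then y v else 0ℚ)
  sum-if-* x b y = trans (sum-cong-≗ λ v → *-if x (b v) (y v))
    (sym (*-distribˡ-sum x λ v → if b v then y v else 0ℚ))

  pullOf-suc : ∀ n b → pullOf (suc n) b ≡
    ρ ℚ.* ((if b zero then m n else 0ℚ) ℚ.+ pullOf n (b ∘ suc))
  pullOf-suc n b = trans
    (cong₂ ℚ._+_ (*-if ρ (b zero) (m n)) (sum-if-* ρ (b ∘ suc) (pull n)))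
    (sym (ℚ.*-distribˡ-+ ρ (if b zero then m n else 0ℚ) (pullOf n (b ∘ suc))))

  if-0+ : ∀ b p → (if b then 0ℚ else 0ℚ) ℚ.+ p ≡ p
  if-0+ true  p = ℚ.+-identityˡ p
  if-0+ false p = ℚ.+-identityˡ p

  -- `geometricWeight` is 0 on pairs ending in the new first vertex, so only the row of that vertex
  -- adds to the old sum.
  weightOf-suc : ∀ n b → weightOf (suc n) b ≡
    m n ℚ.* pullOf n (b zero ∘ suc) ℚ.+ weightOf n (λ u v → b (suc u) (suc v))
  weightOf-suc n b = cong₂ ℚ._+_
    (trans (if-0+ (b zero zero) (sum λ v → if b zero (suc v) then m n ℚ.* pull n v else 0ℚ))
      (sum-if-* (m n) (b zero ∘ suc) (pull n)))
    (sum-cong-≗ λ u → if-0+ (b (suc u) zero)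
      (sum λ v → if b (suc u) (suc v) then geometricWeight n u v else 0ℚ))

  pullOf-cong : ∀ n {b b′} → b ≗ b′ → pullOf n b ≡ pullOf n b′
  pullOf-cong n b≗b′ = sum-cong-≗ λ v → cong (if_then pull n v else 0ℚ) (b≗b′ v)

  pullOf-none : ∀ n → pullOf n (λ _ → false) ≡ 0ℚ
  pullOf-none n = sum-replicate-zero n

  -- Cuts and the potential that bounds them

  crosses : ∀ {n} → Subset n → Fin n → Fin n → Bool
  crosses X u v = lookup X u ∧ lookup (∁ X) v ∧ (u <ᶠ v)

  cutWeight : ∀ n → Subset n → ℚ
  cutWeight n X = weightOf n (crosses X)

  sinkPull : ∀ n → Subset n → ℚ
  sinkPull n X = pullOf n (lookup (∁ X))

  cutWeight-inside : ∀ n X → cutWeight (suc n) (inside ∷ X) ≡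
    m n ℚ.* sinkPull n X ℚ.+ cutWeight n X
  cutWeight-inside n X = trans (weightOf-suc n (crosses (inside ∷ X)))
    (cong (λ p → m n ℚ.* p ℚ.+ cutWeight n X) (pullOf-cong n λ v → ∧-identityʳ _))

  cutWeight-outside : ∀ n X → cutWeight (suc n) (outside ∷ X) ≡ cutWeight n X
  cutWeight-outside n X = trans (weightOf-suc n (crosses (outside ∷ X))) (trans
    (cong (ℚ._+ cutWeight n X) (trans (cong (m n ℚ.*_) (pullOf-none n)) (ℚ.*-zeroʳ (m n))))
    (ℚ.+-identityˡ _))

  massSquares : ℕ → ℚ
  massSquares zero    = 0ℚ
  massSquares (suc n) = massSquares n ℚ.+ m n ℚ.* m n

  δ : ℚ
  δ = 1ℚ ℚ.- ρ ℚ.* ρ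

  potential : ℚ → ℚ → ℚ
  potential cut p = (1ℚ ℚ.+ 1ℚ) ℚ.* ρ ℚ.* δ ℚ.* cut ℚ.+ δ ℚ.* (p ℚ.* p)

  -- The potential is chosen so that adding a source vertex, as well as adding
  -- a sink vertex, changes the two sides by amounts differing by a square.
  potential-source : ∀ x cut p →
    potential (x ℚ.* p ℚ.+ cut) (ρ ℚ.* (0ℚ ℚ.+ p)) ℚ.+ (ρ ℚ.* x ℚ.- δ ℚ.* p) ℚ.* (ρ ℚ.* x ℚ.- δ ℚ.* p)
      ≡ potential cut p ℚ.+ ρ ℚ.* ρ ℚ.* (x ℚ.* x)
  potential-source = solve 4 (λ ρ x c p →
    let δ = con 1ℚ :- ρ :* ρ
        q = ρ :* (con 0ℚ :+ p)
    in ((con 1ℚ :+ con 1ℚ) :* ρ :* δ :* (x :* p :+ c) :+ δ :* (q :* q)) :+ (ρ :* x :- δ :* p) :* (ρ :* x :- δ :* p)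
       := ((con 1ℚ :+ con 1ℚ) :* ρ :* δ :* c :+ δ :* (p :* p)) :+ ρ :* ρ :* (x :* x)) refl ρ
    where open ℚSolver.+-*-Solver

  potential-sink : ∀ x cut p →
    potential cut (ρ ℚ.* (x ℚ.+ p)) ℚ.+ (ρ ℚ.* ρ ℚ.* x ℚ.- δ ℚ.* p) ℚ.* (ρ ℚ.* ρ ℚ.* x ℚ.- δ ℚ.* p)
      ≡ potential cut p ℚ.+ ρ ℚ.* ρ ℚ.* (x ℚ.* x)
  potential-sink = solve 4 (λ ρ x c p →
    let δ = con 1ℚ :- ρ :* ρ
        q = ρ :* (x :+ p)
    in ((con 1ℚ :+ con 1ℚ) :* ρ :* δ :* c :+ δ :* (q :* q)) :+ (ρ :* ρ :* x :- δ :* p) :* (ρ :* ρ :* x :- δ :* p)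
       := ((con 1ℚ :+ con 1ℚ) :* ρ :* δ :* c :+ δ :* (p :* p)) :+ ρ :* ρ :* (x :* x)) refl ρ
    where open ℚSolver.+-*-Solver

  -- Induction on the vertices, added at the front: on either side of the cut, the new vertex raises
  -- the potential by `ρ² m²` minus a square. The bound is thus the same for all `X`.
  potential-≤ : ∀ n X →
    potential (cutWeight n X) (sinkPull n X) ℚ.≤ ρ ℚ.* ρ ℚ.* massSquares n
  potential-≤ zero [] = ℚ.≤-reflexive (solve 2
    (λ x ρ → x :* con 0ℚ :+ (con 1ℚ :- ρ :* ρ) :* con 0ℚ := ρ :* ρ :* con 0ℚ)
    refl ((1ℚ ℚ.+ 1ℚ) ℚ.* ρ ℚ.* δ) ρ)
    where open ℚSolver.+-*-Solver
  potential-≤ (suc n) (b ∷ X) = begin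
    potential (cutWeight (suc n) (b ∷ X)) (sinkPull (suc n) (b ∷ X))
      ≤⟨ step b ⟩
    potential (cutWeight n X) (sinkPull n X) ℚ.+ ρ ℚ.* ρ ℚ.* (m n ℚ.* m n)
      ≤⟨ ℚ.+-monoˡ-≤ (ρ ℚ.* ρ ℚ.* (m n ℚ.* m n)) (potential-≤ n X) ⟩
    ρ ℚ.* ρ ℚ.* massSquares n ℚ.+ ρ ℚ.* ρ ℚ.* (m n ℚ.* m n)
      ≡⟨ ℚ.*-distribˡ-+ (ρ ℚ.* ρ) (massSquares n) (m n ℚ.* m n) ⟨
    ρ ℚ.* ρ ℚ.* massSquares (suc n) ∎
    where
    open ℚ.≤-Reasoning
    p = sinkPull n X
    c′ = cutWeight n X
    step : ∀ b → potential (cutWeight (suc n) (b ∷ X)) (sinkPull (suc n) (b ∷ X)) ℚ.≤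
      potential c′ p ℚ.+ ρ ℚ.* ρ ℚ.* (m n ℚ.* m n)
    -- A source has no pull of its own: `pullOf-suc` produces the summand `0ℚ`, which
    -- `potential-source` keeps in its statement for this reason.
    step true = subst₂ ℚ._≤_
      (sym (cong₂ potential (cutWeight-inside n X) (pullOf-suc n (lookup (∁ (inside ∷ X))))))
      (potential-source (m n) c′ p) (p≤p+q*q _ (ρ ℚ.* m n ℚ.- δ ℚ.* p))
    step false = subst₂ ℚ._≤_
      (sym (cong₂ potential (cutWeight-outside n X) (pullOf-suc n (lookup (∁ (outside ∷ X))))))
      (potential-sink (m n) c′ p) (p≤p+q*q _ (ρ ℚ.* ρ ℚ.* m n ℚ.- δ ℚ.* p))

  seq-weightBetween : ∀ n X i →
    seq (weightBetween (geometricTournament n) X (∁ X)) i ≡ cutWeight n X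
  seq-weightBetween n X i = seq-∑∑-if (crosses X) (geometricWeight n) i

  -- Total weight, by recursion on the vertices

  fullPull : ℕ → ℚ
  fullPull zero    = 0ℚ
  fullPull (suc n) = ρ ℚ.* (m n ℚ.+ fullPull n)

  fullWeight : ℕ → ℚ
  fullWeight zero    = 0ℚ
  fullWeight (suc n) = m n ℚ.* fullPull n ℚ.+ fullWeight n

  pullOf-all : ∀ n → pullOf n (λ _ → true) ≡ fullPull n
  pullOf-all zero    = refl
  pullOf-all (suc n) = trans (pullOf-suc n (λ _ → true)) (cong (λ p → ρ ℚ.* (m n ℚ.+ p)) (pullOf-all n))

  -- Seen from the first vertex the arc relation computes to `true`, and on the remaining vertices
  -- it computes to `_<ᶠ_` again.
  weightOf-arcs : ∀ n → weightOf n _<ᶠ_ ≡ fullWeight n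
  weightOf-arcs zero    = refl
  weightOf-arcs (suc n) = trans (weightOf-suc n _<ᶠ_)
    (cong₂ (λ p q → m n ℚ.* p ℚ.+ q) (pullOf-all n) (weightOf-arcs n))

  seq-totalWeight : ∀ n i → seq (totalWeight (geometricTournament n)) i ≡ fullWeight n
  seq-totalWeight n i = trans (seq-∑∑-if _<ᶠ_ (geometricWeight n) i) (weightOf-arcs n)

-- Masses for which the accumulated pull grows linearly, then stays constant

-- In terms of ratios, `g/s = 1 + y/x` because the factor `l/6` cancels, and `y/x` is at most `b/a`.
ratio-≤ : ∀ a b l x y g s → 6 ℕ.* g ≡ l ℕ.* (x ℕ.+ y) → 6 ℕ.* s ≡ l ℕ.* x →
  a ℕ.* y ℕ.≤ b ℕ.* x → a ℕ.* g ℕ.≤ (a ℕ.+ b) ℕ.* s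
ratio-≤ a b l x y g s 6g≡ 6s≡ ay≤bx = ℕ.*-cancelˡ-≤ 6 (begin
  6 ℕ.* (a ℕ.* g)              ≡⟨ pull-6 a g ⟨
  a ℕ.* (6 ℕ.* g)              ≡⟨ cong (a ℕ.*_) 6g≡ ⟩
  a ℕ.* (l ℕ.* (x ℕ.+ y))      ≡⟨ solve 4 (λ a l x y → a :* (l :* (x :+ y)) := l :* (a :* x :+ a :* y)) refl a l x y ⟩
  l ℕ.* (a ℕ.* x ℕ.+ a ℕ.* y)  ≤⟨ ℕ.*-monoʳ-≤ l (ℕ.+-monoʳ-≤ (a ℕ.* x) ay≤bx) ⟩
  l ℕ.* (a ℕ.* x ℕ.+ b ℕ.* x)  ≡⟨ solve 4 (λ a b l x → l :* (a :* x :+ b :* x) := (a :+ b) :* (l :* x)) refl a b l x ⟩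
  (a ℕ.+ b) ℕ.* (l ℕ.* x)      ≡⟨ cong ((a ℕ.+ b) ℕ.*_) 6s≡ ⟨
  (a ℕ.+ b) ℕ.* (6 ℕ.* s)      ≡⟨ pull-6 (a ℕ.+ b) s ⟩
  6 ℕ.* ((a ℕ.+ b) ℕ.* s)      ∎)
  where
  open ℕ.≤-Reasoning
  open ℕSolver.+-*-Solver
  pull-6 : ∀ a b → a ℕ.* (6 ℕ.* b) ≡ 6 ℕ.* (a ℕ.* b)
  pull-6 = solve 2 (λ a b → a :* (con 6 :* b) := con 6 :* (a :* b)) refl

-- `t` will be `⌊√ν⌋ - 3`. All parameters are then polynomials in `t` with natural coefficients,
-- free of truncated subtraction and accessible to the ring solver.
module Ramp (t : ℕ) where

  -- L = 3r, h = 3r - 7 and E = 2k + 1.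
  k r L h E : ℕ
  k = 2 ℕ.+ t
  r = suc k
  L = 9 ℕ.+ 3 ℕ.* t
  h = 2 ℕ.+ 3 ℕ.* t
  E = 5 ℕ.+ 2 ℕ.* t

  -- Solved from the desired accumulated pull: `fullPull n = k min(n, L)` with `ρ = k/r` forces the
  -- mass `r min(ℓ+1, L) - k min(ℓ, L)`.
  mass : ℕ → ℕ
  mass ℓ = if ℓ ℕ.<ᵇ L then ℓ ℕ.+ r else L

  ρ : ℚ
  ρ = + k ℚ./ r

  open Geometric ρ
    (/-cross-≤ 0 0 k k z≤n)
    (fromℕℚ ∘ mass) (λ ℓ → 0≤fromℕℚ (mass ℓ)) public

  rρ≡k : fromℕℚ r ℚ.* ρ ≡ fromℕℚ k
  rρ≡k = ℚ.toℚᵘ-injective $ begin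
    ℚ.toℚᵘ (fromℕℚ r ℚ.* ρ)                ≈⟨ ℚ.toℚᵘ-homo-* (fromℕℚ r) ρ ⟩
    ℚ.toℚᵘ (fromℕℚ r) ℚᵘ.* ℚ.toℚᵘ ρ        ≈⟨ ℚᵘ.*-cong (toℚᵘ-/ (+ r) 0) (toℚᵘ-/ (+ k) k) ⟩
    ℚᵘ.mkℚᵘ (+ r) 0 ℚᵘ.* ℚᵘ.mkℚᵘ (+ k) k   ≈⟨ ℚᵘ.*≡* (trans (ℤ.*-identityʳ _)
      (trans (ℤ.*-comm (+ r) (+ k)) (cong (λ x → + k ℤ.* + x) (sym (ℕ.*-identityˡ r))))) ⟩
    ℚᵘ.mkℚᵘ (+ k) 0                        ≈⟨ toℚᵘ-/ (+ k) 0 ⟨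
    ℚ.toℚᵘ (fromℕℚ k)                      ∎
    where open ℚᵘ.≃-Reasoning

  mass-< : ∀ {ℓ} → ℓ ℕ.< L → mass ℓ ≡ ℓ ℕ.+ r
  mass-< {ℓ} ℓ<L with ℓ ℕ.<ᵇ L in eq
  ... | true  = refl
  ... | false = contradiction (ℕ.<⇒<ᵇ ℓ<L) (subst T eq)

  mass-≥ : ∀ {ℓ} → L ℕ.≤ ℓ → mass ℓ ≡ L
  mass-≥ {ℓ} L≤ℓ with ℓ ℕ.<ᵇ L in eq
  ... | false = refl
  ... | true  = contradiction L≤ℓ (ℕ.<⇒≱ (ℕ.<ᵇ⇒< ℓ L (subst T (sym eq) _)))

  mass-recurrence : ∀ ℓ → mass ℓ ℕ.+ k ℕ.* (ℓ ℕ.⊓ L) ≡ r ℕ.* (suc ℓ ℕ.⊓ L)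
  mass-recurrence ℓ with ℕ.<-≤-connex ℓ L
  ... | inj₁ ℓ<L = begin
    mass ℓ ℕ.+ k ℕ.* (ℓ ℕ.⊓ L)  ≡⟨ cong₂ (λ x y → x ℕ.+ k ℕ.* y) (mass-< ℓ<L) (ℕ.m≤n⇒m⊓n≡m (ℕ.<⇒≤ ℓ<L)) ⟩
    ℓ ℕ.+ r ℕ.+ k ℕ.* ℓ         ≡⟨ solve 2 (λ ℓ k → ℓ :+ (con 1 :+ k) :+ k :* ℓ := (con 1 :+ k) :* (con 1 :+ ℓ)) refl ℓ k ⟩
    r ℕ.* suc ℓ                 ≡⟨ cong (r ℕ.*_) (ℕ.m≤n⇒m⊓n≡m ℓ<L) ⟨
    r ℕ.* (suc ℓ ℕ.⊓ L)         ∎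
    where
    open ≡-Reasoning
    open ℕSolver.+-*-Solver
  ... | inj₂ L≤ℓ = begin
    mass ℓ ℕ.+ k ℕ.* (ℓ ℕ.⊓ L)  ≡⟨ cong₂ (λ x y → x ℕ.+ k ℕ.* y) (mass-≥ L≤ℓ) (ℕ.m≥n⇒m⊓n≡n L≤ℓ) ⟩
    L ℕ.+ k ℕ.* L               ≡⟨ cong (r ℕ.*_) (ℕ.m≥n⇒m⊓n≡n (ℕ.m≤n⇒m≤1+n L≤ℓ)) ⟨
    r ℕ.* (suc ℓ ℕ.⊓ L)         ∎
    where open ≡-Reasoning

  -- The factor `r` supplied by `mass-recurrence` cancels the denominator of `ρ`, so all pulls are
  -- integers and the total weight can be computed in ℕ.
  fullPull-⊓ : ∀ n → fullPull n ≡ fromℕℚ (k ℕ.* (n ℕ.⊓ L))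
  fullPull-⊓ zero    = cong fromℕℚ (sym (ℕ.*-zeroʳ k))
  fullPull-⊓ (suc n) = begin
    ρ ℚ.* (fromℕℚ (mass n) ℚ.+ fullPull n)                      ≡⟨ cong (λ p → ρ ℚ.* (fromℕℚ (mass n) ℚ.+ p)) (fullPull-⊓ n) ⟩
    ρ ℚ.* (fromℕℚ (mass n) ℚ.+ fromℕℚ (k ℕ.* (n ℕ.⊓ L)))        ≡⟨ cong (ρ ℚ.*_) (fromℕℚ-+ (mass n) (k ℕ.* (n ℕ.⊓ L))) ⟨
    ρ ℚ.* fromℕℚ (mass n ℕ.+ k ℕ.* (n ℕ.⊓ L))                   ≡⟨ cong (λ x → ρ ℚ.* fromℕℚ x) (mass-recurrence n) ⟩
    ρ ℚ.* fromℕℚ (r ℕ.* (suc n ℕ.⊓ L))                          ≡⟨ cong (ρ ℚ.*_) (fromℕℚ-* r (suc n ℕ.⊓ L)) ⟩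
    ρ ℚ.* (fromℕℚ r ℚ.* fromℕℚ (suc n ℕ.⊓ L))                   ≡⟨ ℚ.*-assoc ρ (fromℕℚ r) _ ⟨
    ρ ℚ.* fromℕℚ r ℚ.* fromℕℚ (suc n ℕ.⊓ L)                     ≡⟨ cong (ℚ._* fromℕℚ (suc n ℕ.⊓ L)) (trans (ℚ.*-comm ρ (fromℕℚ r)) rρ≡k) ⟩
    fromℕℚ k ℚ.* fromℕℚ (suc n ℕ.⊓ L)                           ≡⟨ fromℕℚ-* k (suc n ℕ.⊓ L) ⟨
    fromℕℚ (k ℕ.* (suc n ℕ.⊓ L))                                ∎
    where open ≡-Reasoning

  -- Closed forms for the total weight and the squared masses

  S Γ : ℕ → ℕ
  S zero    = 0
  S (suc n) = mass n ℕ.* (n ℕ.⊓ L) ℕ.+ S n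
  Γ zero    = 0
  Γ (suc n) = Γ n ℕ.+ mass n ℕ.* mass n

  massSquares-Γ : ∀ n → massSquares n ≡ fromℕℚ (Γ n)
  massSquares-Γ zero    = refl
  massSquares-Γ (suc n) = sym (trans (fromℕℚ-+ (Γ n) (mass n ℕ.* mass n))
    (cong₂ ℚ._+_ (sym (massSquares-Γ n)) (fromℕℚ-* (mass n) (mass n))))

  fullWeight-S : ∀ n → fullWeight n ≡ fromℕℚ (k ℕ.* S n)
  fullWeight-S zero    = cong fromℕℚ (sym (ℕ.*-zeroʳ k))
  fullWeight-S (suc n) = begin
    fromℕℚ (mass n) ℚ.* fullPull n ℚ.+ fullWeight n
      ≡⟨ cong₂ (λ p q → fromℕℚ (mass n) ℚ.* p ℚ.+ q) (fullPull-⊓ n) (fullWeight-S n) ⟩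
    fromℕℚ (mass n) ℚ.* fromℕℚ (k ℕ.* (n ℕ.⊓ L)) ℚ.+ fromℕℚ (k ℕ.* S n)
      ≡⟨ cong (ℚ._+ fromℕℚ (k ℕ.* S n)) (fromℕℚ-* (mass n) (k ℕ.* (n ℕ.⊓ L))) ⟨
    fromℕℚ (mass n ℕ.* (k ℕ.* (n ℕ.⊓ L))) ℚ.+ fromℕℚ (k ℕ.* S n)
      ≡⟨ fromℕℚ-+ (mass n ℕ.* (k ℕ.* (n ℕ.⊓ L))) (k ℕ.* S n) ⟨
    fromℕℚ (mass n ℕ.* (k ℕ.* (n ℕ.⊓ L)) ℕ.+ k ℕ.* S n)
      ≡⟨ cong fromℕℚ (solve 4 (λ m k u s → m :* (k :* u) :+ k :* s := k :* (m :* u :+ s)) refl (mass n) k (n ℕ.⊓ L) (S n)) ⟩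
    fromℕℚ (k ℕ.* S (suc n)) ∎
    where
    open ≡-Reasoning
    open ℕSolver.+-*-Solver

  -- The sum of `i² + r i` over `i ≤ p`. Stating it at `suc p` avoids `p - 1` in the formula.
  S-ramp : ∀ p → suc p ℕ.≤ L →
    6 ℕ.* S (suc p) ≡ p ℕ.* suc p ℕ.* (1 ℕ.+ 2 ℕ.* p ℕ.+ 3 ℕ.* r)
  S-ramp zero    _    = cong (6 ℕ.*_) (cong (ℕ._+ 0) (ℕ.*-zeroʳ (mass 0)))
  S-ramp (suc p) p+1<L = begin
    6 ℕ.* (mass (suc p) ℕ.* (suc p ℕ.⊓ L) ℕ.+ S (suc p))
      ≡⟨ ℕ.*-distribˡ-+ 6 (mass (suc p) ℕ.* (suc p ℕ.⊓ L)) (S (suc p)) ⟩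
    6 ℕ.* (mass (suc p) ℕ.* (suc p ℕ.⊓ L)) ℕ.+ 6 ℕ.* S (suc p)
      ≡⟨ cong₂ ℕ._+_ (cong₂ (λ x y → 6 ℕ.* (x ℕ.* y)) (mass-< p+1<L) (ℕ.m≤n⇒m⊓n≡m (ℕ.<⇒≤ p+1<L)))
           (S-ramp p (ℕ.<⇒≤ p+1<L)) ⟩
    6 ℕ.* ((suc p ℕ.+ r) ℕ.* suc p) ℕ.+ p ℕ.* suc p ℕ.* (1 ℕ.+ 2 ℕ.* p ℕ.+ 3 ℕ.* r)
      ≡⟨ solve 2 (λ p r → con 6 :* ((con 1 :+ p :+ r) :* (con 1 :+ p)) :+ p :* (con 1 :+ p) :* (con 1 :+ con 2 :* p :+ con 3 :* r)
           := (con 1 :+ p) :* (con 2 :+ p) :* (con 1 :+ con 2 :* (con 1 :+ p) :+ con 3 :* r)) refl p r ⟩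
    suc p ℕ.* suc (suc p) ℕ.* (1 ℕ.+ 2 ℕ.* suc p ℕ.+ 3 ℕ.* r) ∎
    where
    open ≡-Reasoning
    open ℕSolver.+-*-Solver

  -- The sum of `(i + r)²` over `i ≤ p`, expanded into power sums.
  Γ-ramp : ∀ p → suc p ℕ.≤ L →
    6 ℕ.* Γ (suc p) ≡ p ℕ.* suc p ℕ.* (1 ℕ.+ 2 ℕ.* p ℕ.+ 6 ℕ.* r) ℕ.+ 6 ℕ.* (r ℕ.* r) ℕ.* suc p
  Γ-ramp zero 0<L = trans (cong (λ x → 6 ℕ.* (x ℕ.* x)) (mass-< 0<L)) (sym (ℕ.*-identityʳ _))
  Γ-ramp (suc p) p+1<L = begin
    6 ℕ.* (Γ (suc p) ℕ.+ mass (suc p) ℕ.* mass (suc p))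
      ≡⟨ ℕ.*-distribˡ-+ 6 (Γ (suc p)) (mass (suc p) ℕ.* mass (suc p)) ⟩
    6 ℕ.* Γ (suc p) ℕ.+ 6 ℕ.* (mass (suc p) ℕ.* mass (suc p))
      ≡⟨ cong₂ ℕ._+_ (Γ-ramp p (ℕ.<⇒≤ p+1<L)) (cong (λ x → 6 ℕ.* (x ℕ.* x)) (mass-< p+1<L)) ⟩
    p ℕ.* suc p ℕ.* (1 ℕ.+ 2 ℕ.* p ℕ.+ 6 ℕ.* r) ℕ.+ 6 ℕ.* (r ℕ.* r) ℕ.* suc p ℕ.+ 6 ℕ.* ((suc p ℕ.+ r) ℕ.* (suc p ℕ.+ r))
      ≡⟨ solve 2 (λ p r → p :* (con 1 :+ p) :* (con 1 :+ con 2 :* p :+ con 6 :* r) :+ con 6 :* (r :* r) :* (con 1 :+ p)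
             :+ con 6 :* ((con 1 :+ p :+ r) :* (con 1 :+ p :+ r))
           := (con 1 :+ p) :* (con 2 :+ p) :* (con 1 :+ con 2 :* (con 1 :+ p) :+ con 6 :* r) :+ con 6 :* (r :* r) :* (con 2 :+ p)) refl p r ⟩
    suc p ℕ.* suc (suc p) ℕ.* (1 ℕ.+ 2 ℕ.* suc p ℕ.+ 6 ℕ.* r) ℕ.+ 6 ℕ.* (r ℕ.* r) ℕ.* suc (suc p) ∎
    where
    open ≡-Reasoning
    open ℕSolver.+-*-Solver

  -- Beyond the ramp the mass and the pull divided by `k` both equal `L`, so a vertex adds `L²` to
  -- `S` and likewise to `Γ`. The gap between `Γ` and `S` therefore comes from the ramp alone.
  S-flat : ∀ f → S (f ℕ.+ L) ≡ f ℕ.* (L ℕ.* L) ℕ.+ S L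
  S-flat zero    = refl
  S-flat (suc f) = trans
    (cong₂ ℕ._+_ (cong₂ ℕ._*_ (mass-≥ (ℕ.m≤n+m L f)) (ℕ.m≥n⇒m⊓n≡n (ℕ.m≤n+m L f))) (S-flat f))
    (sym (ℕ.+-assoc (L ℕ.* L) _ _))

  Γ-flat : ∀ f → Γ (f ℕ.+ L) ≡ f ℕ.* (L ℕ.* L) ℕ.+ Γ L
  Γ-flat zero    = refl
  Γ-flat (suc f) = trans
    (cong₂ ℕ._+_ (Γ-flat f) (cong (λ x → x ℕ.* x) (mass-≥ (ℕ.m≤n+m L f))))
    (trans (ℕ.+-comm _ (L ℕ.* L)) (sym (ℕ.+-assoc (L ℕ.* L) _ _)))

  -- With ν = e + r², the number of vertices beyond the first L.
  flat : ℕ → ℕ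
  flat e = e ℕ.+ t ℕ.* (3 ℕ.+ t)

  e+r²≡flat+L : ∀ e → e ℕ.+ r ℕ.* r ≡ flat e ℕ.+ L
  e+r²≡flat+L e = solve 2 (λ e t → e :+ (con 3 :+ t) :* (con 3 :+ t) := e :+ t :* (con 3 :+ t) :+ (con 9 :+ con 3 :* t)) refl e t
    where open ℕSolver.+-*-Solver

  -- S and Γ at f + L are L X/6 and L Y/6.
  X Y : ℕ → ℕ
  X f = 6 ℕ.* (f ℕ.* L) ℕ.+ (8 ℕ.+ 3 ℕ.* t) ℕ.* (26 ℕ.+ 9 ℕ.* t)
  Y f = X f ℕ.+ 3 ℕ.* r ℕ.* (14 ℕ.+ 5 ℕ.* t)

  S-closed : ∀ f → 6 ℕ.* S (f ℕ.+ L) ≡ L ℕ.* X f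
  S-closed f = begin
    6 ℕ.* S (f ℕ.+ L)                             ≡⟨ cong (6 ℕ.*_) (S-flat f) ⟩
    6 ℕ.* (f ℕ.* (L ℕ.* L) ℕ.+ S L)               ≡⟨ ℕ.*-distribˡ-+ 6 (f ℕ.* (L ℕ.* L)) (S L) ⟩
    6 ℕ.* (f ℕ.* (L ℕ.* L)) ℕ.+ 6 ℕ.* S L         ≡⟨ cong (6 ℕ.* (f ℕ.* (L ℕ.* L)) ℕ.+_) (S-ramp p ℕ.≤-refl) ⟩
    6 ℕ.* (f ℕ.* (L ℕ.* L)) ℕ.+ p ℕ.* L ℕ.* (1 ℕ.+ 2 ℕ.* p ℕ.+ 3 ℕ.* r)
      ≡⟨ cong (λ x → 6 ℕ.* (f ℕ.* (L ℕ.* L)) ℕ.+ p ℕ.* L ℕ.* x)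
           (solve 1 (λ t → con 1 :+ con 2 :* (con 8 :+ con 3 :* t) :+ con 3 :* (con 3 :+ t) := con 26 :+ con 9 :* t) refl t) ⟩
    6 ℕ.* (f ℕ.* (L ℕ.* L)) ℕ.+ p ℕ.* L ℕ.* (26 ℕ.+ 9 ℕ.* t)
      ≡⟨ solve 4 (λ f L p x → con 6 :* (f :* (L :* L)) :+ p :* L :* x := L :* (con 6 :* (f :* L) :+ p :* x)) refl f L p (26 ℕ.+ 9 ℕ.* t) ⟩
    L ℕ.* X f                                     ∎
    where
    open ≡-Reasoning
    open ℕSolver.+-*-Solver
    -- The last index of the ramp: `suc p` computes to `L`.
    p = 8 ℕ.+ 3 ℕ.* t

  -- `Γ` exceeds `S` by the sum of `r (i + r)` over the ramp, which is `L/6` times the summand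
  -- `3r(p + 2r)` of `Y`.
  Γ-closed : ∀ f → 6 ℕ.* Γ (f ℕ.+ L) ≡ L ℕ.* Y f
  Γ-closed f = begin
    6 ℕ.* Γ (f ℕ.+ L)                             ≡⟨ cong (6 ℕ.*_) (Γ-flat f) ⟩
    6 ℕ.* (f ℕ.* (L ℕ.* L) ℕ.+ Γ L)               ≡⟨ ℕ.*-distribˡ-+ 6 (f ℕ.* (L ℕ.* L)) (Γ L) ⟩
    6 ℕ.* (f ℕ.* (L ℕ.* L)) ℕ.+ 6 ℕ.* Γ L         ≡⟨ cong (6 ℕ.* (f ℕ.* (L ℕ.* L)) ℕ.+_) (Γ-ramp p ℕ.≤-refl) ⟩
    6 ℕ.* (f ℕ.* (L ℕ.* L)) ℕ.+ (p ℕ.* L ℕ.* (1 ℕ.+ 2 ℕ.* p ℕ.+ 6 ℕ.* r) ℕ.+ 6 ℕ.* (r ℕ.* r) ℕ.* L)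
      ≡⟨ solve 4 (λ f L p r → con 6 :* (f :* (L :* L)) :+ (p :* L :* (con 1 :+ con 2 :* p :+ con 6 :* r) :+ con 6 :* (r :* r) :* L)
           := L :* (con 6 :* (f :* L) :+ p :* (con 1 :+ con 2 :* p :+ con 3 :* r) :+ con 3 :* r :* (p :+ con 2 :* r))) refl f L p r ⟩
    L ℕ.* (6 ℕ.* (f ℕ.* L) ℕ.+ p ℕ.* (1 ℕ.+ 2 ℕ.* p ℕ.+ 3 ℕ.* r) ℕ.+ 3 ℕ.* r ℕ.* (p ℕ.+ 2 ℕ.* r))
      ≡⟨ cong₂ (λ x y → L ℕ.* (6 ℕ.* (f ℕ.* L) ℕ.+ p ℕ.* x ℕ.+ 3 ℕ.* r ℕ.* y))
           (solve 1 (λ t → con 1 :+ con 2 :* (con 8 :+ con 3 :* t) :+ con 3 :* (con 3 :+ t) := con 26 :+ con 9 :* t) refl t)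
           (solve 1 (λ t → con 8 :+ con 3 :* t :+ con 2 :* (con 3 :+ t) := con 14 :+ con 5 :* t) refl t) ⟩
    L ℕ.* Y f                                     ∎
    where
    open ≡-Reasoning
    open ℕSolver.+-*-Solver
    p = 8 ℕ.+ 3 ℕ.* t

  -- The numerical comparison of `Γ` with `S`

  2rh+18+5t : E ℕ.* (4 ℕ.+ h) ≡ 2 ℕ.* r ℕ.* h ℕ.+ (18 ℕ.+ 5 ℕ.* t)
  2rh+18+5t = solve 1 (λ t → (con 5 :+ con 2 :* t) :* (con 6 :+ con 3 :* t)
    := con 2 :* (con 3 :+ t) :* (con 2 :+ con 3 :* t) :+ (con 18 :+ con 5 :* t)) refl t
    where open ℕSolver.+-*-Solver

  -- `23 + 18t` is a linear lower bound for `X/r²` at `ν = r²`, and further flat vertices only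
  -- increase `X`. What remains are two polynomial inequalities whose differences have nonnegative
  -- coefficients.
  excess-≤ : ∀ f → t ℕ.* (3 ℕ.+ t) ℕ.≤ f →
    2 ℕ.* r ℕ.* h ℕ.* (3 ℕ.* r ℕ.* (14 ℕ.+ 5 ℕ.* t)) ℕ.≤ (18 ℕ.+ 5 ℕ.* t) ℕ.* X f
  excess-≤ f f≥ = begin
    2 ℕ.* r ℕ.* h ℕ.* (3 ℕ.* r ℕ.* (14 ℕ.+ 5 ℕ.* t))
      ≡⟨ solve 3 (λ r h x → con 2 :* r :* h :* (con 3 :* r :* x) := r :* r :* (con 6 :* h :* x)) refl r h (14 ℕ.+ 5 ℕ.* t) ⟩
    r ℕ.* r ℕ.* (6 ℕ.* h ℕ.* (14 ℕ.+ 5 ℕ.* t))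
      ≤⟨ ℕ.*-monoʳ-≤ (r ℕ.* r) 6hy≤ ⟩
    r ℕ.* r ℕ.* ((18 ℕ.+ 5 ℕ.* t) ℕ.* (23 ℕ.+ 18 ℕ.* t))
      ≡⟨ solve 3 (λ r x y → r :* r :* (x :* y) := x :* (r :* r :* y)) refl r (18 ℕ.+ 5 ℕ.* t) (23 ℕ.+ 18 ℕ.* t) ⟩
    (18 ℕ.+ 5 ℕ.* t) ℕ.* (r ℕ.* r ℕ.* (23 ℕ.+ 18 ℕ.* t))
      ≤⟨ ℕ.*-monoʳ-≤ (18 ℕ.+ 5 ℕ.* t) r²z≤X ⟩
    (18 ℕ.+ 5 ℕ.* t) ℕ.* X (t ℕ.* (3 ℕ.+ t))
      ≤⟨ ℕ.*-monoʳ-≤ (18 ℕ.+ 5 ℕ.* t) X-mono ⟩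
    (18 ℕ.+ 5 ℕ.* t) ℕ.* X f ∎
    where
    open ℕ.≤-Reasoning
    open ℕSolver.+-*-Solver
    6hy≤ : 6 ℕ.* h ℕ.* (14 ℕ.+ 5 ℕ.* t) ℕ.≤ (18 ℕ.+ 5 ℕ.* t) ℕ.* (23 ℕ.+ 18 ℕ.* t)
    -- Both sides have leading term `90t²`, so the slope 3 of `h` in `r` leaves only linear slack
    -- here.
    6hy≤ = ℕ.m+n≤o⇒m≤o (6 ℕ.* h ℕ.* (14 ℕ.+ 5 ℕ.* t)) (ℕ.≤-reflexive (solve 1 (λ t →
      con 6 :* (con 2 :+ con 3 :* t) :* (con 14 :+ con 5 :* t) :+ (con 246 :+ con 127 :* t)
      := (con 18 :+ con 5 :* t) :* (con 23 :+ con 18 :* t)) refl t))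
    r²z≤X : r ℕ.* r ℕ.* (23 ℕ.+ 18 ℕ.* t) ℕ.≤ X (t ℕ.* (3 ℕ.+ t))
    r²z≤X = ℕ.m+n≤o⇒m≤o (r ℕ.* r ℕ.* (23 ℕ.+ 18 ℕ.* t)) (ℕ.≤-reflexive (solve 1 (λ t →
      (con 3 :+ t) :* (con 3 :+ t) :* (con 23 :+ con 18 :* t) :+ (con 1 :+ con 12 :* t :+ con 4 :* t :* t)
      := con 6 :* (t :* (con 3 :+ t) :* (con 9 :+ con 3 :* t)) :+ (con 8 :+ con 3 :* t) :* (con 26 :+ con 9 :* t)) refl t))
    X-mono : X (t ℕ.* (3 ℕ.+ t)) ℕ.≤ X f
    X-mono = ℕ.+-monoˡ-≤ ((8 ℕ.+ 3 ℕ.* t) ℕ.* (26 ℕ.+ 9 ℕ.* t)) (ℕ.*-monoʳ-≤ 6 (ℕ.*-monoˡ-≤ L f≥))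

  -- The cut bound is `k r Γ / (2E)` and the total weight is `k S`; this is exactly what makes the
  -- former at most `1/4 + 1/h` times the latter. Writing the right-hand factor as `2rh + (18 + 5t)`
  -- gives it the form `a + b` of `ratio-≤`.
  Γ≤S : ∀ e → 2 ℕ.* r ℕ.* h ℕ.* Γ (flat e ℕ.+ L) ℕ.≤ E ℕ.* (4 ℕ.+ h) ℕ.* S (flat e ℕ.+ L)
  Γ≤S e = subst (λ c → 2 ℕ.* r ℕ.* h ℕ.* Γ (flat e ℕ.+ L) ℕ.≤ c ℕ.* S (flat e ℕ.+ L)) (sym 2rh+18+5t)
    (ratio-≤ (2 ℕ.* r ℕ.* h) (18 ℕ.+ 5 ℕ.* t) L (X (flat e)) (3 ℕ.* r ℕ.* (14 ℕ.+ 5 ℕ.* t))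
      (Γ (flat e ℕ.+ L)) (S (flat e ℕ.+ L)) (Γ-closed (flat e)) (S-closed (flat e))
      (excess-≤ (flat e) (ℕ.m≤n+m (t ℕ.* (3 ℕ.+ t)) e)))

  0<X : ∀ f → 0 ℕ.< X f
  0<X f = ℕ.<-≤-trans (s≤s z≤n) (ℕ.m≤n+m ((8 ℕ.+ 3 ℕ.* t) ℕ.* (26 ℕ.+ 9 ℕ.* t)) (6 ℕ.* (f ℕ.* L)))

  0<S : ∀ e → 0 ℕ.< S (flat e ℕ.+ L)
  0<S e = ℕ.*-cancelˡ-< 6 0 (S (flat e ℕ.+ L)) (subst (0 ℕ.<_) (sym (S-closed (flat e)))
    (ℕ.<-≤-trans (0<X (flat e)) (ℕ.m≤n*m (X (flat e)) L)))

  -- The cut bound with denominators cleared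

  K R : ℚ
  K = fromℕℚ k
  R = fromℕℚ r

  E≡1+2K : fromℕℚ E ≡ 1ℚ ℚ.+ (K ℚ.+ K)
  E≡1+2K = begin
    fromℕℚ E                        ≡⟨ cong fromℕℚ (solve 1 (λ t → con 5 :+ con 2 :* t := con 1 :+ ((con 2 :+ t) :+ (con 2 :+ t))) refl t) ⟩
    fromℕℚ (1 ℕ.+ (k ℕ.+ k))        ≡⟨ fromℕℚ-+ 1 (k ℕ.+ k) ⟩
    1ℚ ℚ.+ fromℕℚ (k ℕ.+ k)         ≡⟨ cong (1ℚ ℚ.+_) (fromℕℚ-+ k k) ⟩
    1ℚ ℚ.+ (K ℚ.+ K)                ∎
    where
    open ≡-Reasoning
    open ℕSolver.+-*-Solver

  -- Since `r = k + 1`, this is `r² - k² = 2k + 1`.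
  R²δ≡E : R ℚ.* R ℚ.* δ ≡ fromℕℚ E
  R²δ≡E = begin
    R ℚ.* R ℚ.* (1ℚ ℚ.- ρ ℚ.* ρ)         ≡⟨ solve 2 (λ R ρ → R :* R :* (con 1ℚ :- ρ :* ρ) := R :* R :- (R :* ρ) :* (R :* ρ)) refl R ρ ⟩
    R ℚ.* R ℚ.- (R ℚ.* ρ) ℚ.* (R ℚ.* ρ)  ≡⟨ cong₂ (λ x y → x ℚ.* x ℚ.- y ℚ.* y) (fromℕℚ-+ 1 k) rρ≡k ⟩
    (1ℚ ℚ.+ K) ℚ.* (1ℚ ℚ.+ K) ℚ.- K ℚ.* K ≡⟨ solve 1 (λ K → (con 1ℚ :+ K) :* (con 1ℚ :+ K) :- K :* K := con 1ℚ :+ (K :+ K)) refl K ⟩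
    1ℚ ℚ.+ (K ℚ.+ K)                     ≡⟨ E≡1+2K ⟨
    fromℕℚ E                             ∎
    where
    open ≡-Reasoning
    open ℚSolver.+-*-Solver

  -- `potential-≤` multiplied by `R³`, which clears the denominators of `ρ` and `δ`, with the
  -- nonnegative `p²` term dropped.
  2KE*cutWeight-≤ : ∀ n X →
    (1ℚ ℚ.+ 1ℚ) ℚ.* (K ℚ.* fromℕℚ E) ℚ.* cutWeight n X ℚ.≤ K ℚ.* K ℚ.* R ℚ.* massSquares n
  2KE*cutWeight-≤ n X = begin
    2K′ ℚ.* c′
      ≡⟨ ℚ.+-identityʳ (2K′ ℚ.* c′) ⟨
    2K′ ℚ.* c′ ℚ.+ 0ℚ
      ≤⟨ ℚ.+-monoʳ-≤ (2K′ ℚ.* c′) (0≤*0≤ (0≤*0≤ (0≤fromℕℚ r) (0≤fromℕℚ E)) (0≤p*p p)) ⟩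
    2K′ ℚ.* c′ ℚ.+ R ℚ.* fromℕℚ E ℚ.* (p ℚ.* p)
      ≡⟨ cong₂ (λ x y → (1ℚ ℚ.+ 1ℚ) ℚ.* (x ℚ.* y) ℚ.* c′ ℚ.+ R ℚ.* y ℚ.* (p ℚ.* p)) rρ≡k R²δ≡E ⟨
    (1ℚ ℚ.+ 1ℚ) ℚ.* (R ℚ.* ρ ℚ.* (R ℚ.* R ℚ.* δ)) ℚ.* c′ ℚ.+ R ℚ.* (R ℚ.* R ℚ.* δ) ℚ.* (p ℚ.* p)
      ≡⟨ solve 5 (λ R ρ δ c p → (con 1ℚ :+ con 1ℚ) :* (R :* ρ :* (R :* R :* δ)) :* c :+ R :* (R :* R :* δ) :* (p :* p)
           := R :* R :* R :* ((con 1ℚ :+ con 1ℚ) :* ρ :* δ :* c :+ δ :* (p :* p))) refl R ρ δ c′ p ⟩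
    R ℚ.* R ℚ.* R ℚ.* potential c′ p
      ≤⟨ ℚ.*-monoˡ-≤-nonNeg (R ℚ.* R ℚ.* R)
           {{ℚ.nonNegative (0≤*0≤ (0≤*0≤ (0≤fromℕℚ r) (0≤fromℕℚ r)) (0≤fromℕℚ r))}} (potential-≤ n X) ⟩
    R ℚ.* R ℚ.* R ℚ.* (ρ ℚ.* ρ ℚ.* massSquares n)
      ≡⟨ solve 3 (λ R ρ g → R :* R :* R :* (ρ :* ρ :* g) := (R :* ρ) :* (R :* ρ) :* R :* g) refl R ρ (massSquares n) ⟩
    (R ℚ.* ρ) ℚ.* (R ℚ.* ρ) ℚ.* R ℚ.* massSquares n
      ≡⟨ cong (λ x → x ℚ.* x ℚ.* R ℚ.* massSquares n) rρ≡k ⟩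
    K ℚ.* K ℚ.* R ℚ.* massSquares n ∎
    where
    open ℚ.≤-Reasoning
    open ℚSolver.+-*-Solver
    2K′ = (1ℚ ℚ.+ 1ℚ) ℚ.* (K ℚ.* fromℕℚ E)
    c′ = cutWeight n X
    p = sinkPull n X

  cutWeight-≤ : ∀ e X → fromℕℚ 4 ℚ.* fromℕℚ h ℚ.* cutWeight (flat e ℕ.+ L) X ℚ.≤
    fromℕℚ (4 ℕ.+ h) ℚ.* fullWeight (flat e ℕ.+ L)
  -- The positive factor `K E` makes both the cut bound and `Γ≤S` applicable, and is cancelled
  -- afterwards.
  cutWeight-≤ e X = ℚ.*-cancelˡ-≤-pos (K ℚ.* E′) {{ℚ.pos*pos⇒pos K {{fromℕℚ-suc-pos (1 ℕ.+ t)}} E′ {{fromℕℚ-suc-pos (4 ℕ.+ 2 ℕ.* t)}}}} (begin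
    K ℚ.* E′ ℚ.* (fromℕℚ 4 ℚ.* H ℚ.* c′)
      ≡⟨ solve 4 (λ K E H c → K :* E :* (con (fromℕℚ 4) :* H :* c) := con (fromℕℚ 2) :* H :* (con (fromℕℚ 2) :* (K :* E) :* c)) refl K E′ H c′ ⟩
    fromℕℚ 2 ℚ.* H ℚ.* (fromℕℚ 2 ℚ.* (K ℚ.* E′) ℚ.* c′)
      ≤⟨ ℚ.*-monoˡ-≤-nonNeg (fromℕℚ 2 ℚ.* H) {{ℚ.nonNegative (0≤*0≤ (0≤fromℕℚ 2) (0≤fromℕℚ h))}} (2KE*cutWeight-≤ n X) ⟩
    fromℕℚ 2 ℚ.* H ℚ.* (K ℚ.* K ℚ.* R ℚ.* massSquares n)
      ≡⟨ solve 4 (λ K R H g → con (fromℕℚ 2) :* H :* (K :* K :* R :* g) := K :* K :* (con (fromℕℚ 2) :* R :* H :* g)) refl K R H (massSquares n) ⟩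
    K ℚ.* K ℚ.* (fromℕℚ 2 ℚ.* R ℚ.* H ℚ.* massSquares n)
      ≡⟨ cong (K ℚ.* K ℚ.*_) Γ-cast ⟨
    K ℚ.* K ℚ.* fromℕℚ (2 ℕ.* r ℕ.* h ℕ.* Γ n)
      ≤⟨ ℚ.*-monoˡ-≤-nonNeg (K ℚ.* K) {{ℚ.nonNegative (0≤p*p K)}} (fromℕℚ-mono-≤ (Γ≤S e)) ⟩
    K ℚ.* K ℚ.* fromℕℚ (E ℕ.* (4 ℕ.+ h) ℕ.* S n)
      ≡⟨ cong (K ℚ.* K ℚ.*_) S-cast ⟩
    K ℚ.* K ℚ.* (E′ ℚ.* fromℕℚ (4 ℕ.+ h) ℚ.* fromℕℚ (S n))
      ≡⟨ solve 4 (λ K E h s → K :* K :* (E :* h :* s) := K :* E :* (h :* (K :* s))) refl K E′ (fromℕℚ (4 ℕ.+ h)) (fromℕℚ (S n)) ⟩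
    K ℚ.* E′ ℚ.* (fromℕℚ (4 ℕ.+ h) ℚ.* (K ℚ.* fromℕℚ (S n)))
      ≡⟨ cong (λ w → K ℚ.* E′ ℚ.* (fromℕℚ (4 ℕ.+ h) ℚ.* w)) (trans (fullWeight-S n) (fromℕℚ-* k (S n))) ⟨
    K ℚ.* E′ ℚ.* (fromℕℚ (4 ℕ.+ h) ℚ.* fullWeight n) ∎)
    where
    open ℚ.≤-Reasoning
    open ℚSolver.+-*-Solver
    n = flat e ℕ.+ L
    E′ = fromℕℚ E
    H = fromℕℚ h
    c′ = cutWeight n X
    Γ-cast : fromℕℚ (2 ℕ.* r ℕ.* h ℕ.* Γ n) ≡ fromℕℚ 2 ℚ.* R ℚ.* H ℚ.* massSquares n
    Γ-cast = trans (fromℕℚ-* (2 ℕ.* r ℕ.* h) (Γ n)) (cong₂ ℚ._*_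
      (trans (fromℕℚ-* (2 ℕ.* r) h) (cong (ℚ._* H) (fromℕℚ-* 2 r))) (sym (massSquares-Γ n)))
    S-cast : fromℕℚ (E ℕ.* (4 ℕ.+ h) ℕ.* S n) ≡ E′ ℚ.* fromℕℚ (4 ℕ.+ h) ℚ.* fromℕℚ (S n)
    S-cast = trans (fromℕℚ-* (E ℕ.* (4 ℕ.+ h)) (S n)) (cong (ℚ._* fromℕℚ (S n)) (fromℕℚ-* E (4 ℕ.+ h)))

  0<fullWeight : ∀ e → 0ℚ ℚ.< fullWeight (flat e ℕ.+ L)
  0<fullWeight e = subst (0ℚ ℚ.<_) (sym (trans (fullWeight-S n) (fromℕℚ-* k (S n))))
    (ℚ.positive⁻¹ _ {{ℚ.pos*pos⇒pos K {{fromℕℚ-suc-pos (1 ℕ.+ t)}} (fromℕℚ (S n)) {{S>0}}}})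
    where
    n = flat e ℕ.+ L
    S>0 : ℚ.Positive (fromℕℚ (S n))
    S>0 = ℚ.positive (/-cross-< 0 0 (S n) 0 (ℕ.≤-trans (0<S e) (ℕ.≤-reflexive (sym (ℕ.*-identityʳ (S n))))))

  extremal : ℕ → WeightedDigraph
  extremal e = geometricTournament (flat e ℕ.+ L)

  mac-extremal-≤ : ∀ e i → fromℕℚ 4 ℚ.* fromℕℚ h ℚ.* seq (mac (extremal e)) i ℚ.≤
    fromℕℚ (4 ℕ.+ h) ℚ.* fullWeight (flat e ℕ.+ L)
  mac-extremal-≤ e i = maxOverSubsets-elim
    (λ x → fromℕℚ 4 ℚ.* fromℕℚ h ℚ.* x ℚ.≤ fromℕℚ (4 ℕ.+ h) ℚ.* fullWeight (flat e ℕ.+ L))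
    (λ X → weightBetween (extremal e) X (∁ X)) i
    (λ X → subst (λ x → fromℕℚ 4 ℚ.* fromℕℚ h ℚ.* x ℚ.≤ fromℕℚ (4 ℕ.+ h) ℚ.* fullWeight (flat e ℕ.+ L))
      (sym (seq-weightBetween (flat e ℕ.+ L) X i)) (cutWeight-≤ e X))

-- Rounding the square root and the final estimate

√seq-≤ : ∀ ν n → √seq ν n ℚ.≤ fromℕℚ (suc (isqrt ν))
√seq-≤ ν n = /-cross-≤ (√num ν n) n (suc r) 0 (subst (ℕ._≤ suc r ℕ.* suc n) (sym (ℕ.*-identityʳ (√num ν n)))
  (ℕ.<⇒≤ (square-cancel-< {√num ν n} {suc r ℕ.* suc n} (begin-strict
    √num ν n ℕ.* √num ν n                       ≤⟨ isqrt²≤ (ν ℕ.* (suc n ℕ.* suc n)) ⟩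
    ν ℕ.* (suc n ℕ.* suc n)                     <⟨ ℕ.*-monoˡ-< (suc n ℕ.* suc n) (<[1+isqrt]² ν) ⟩
    suc r ℕ.* suc r ℕ.* (suc n ℕ.* suc n)       ≡⟨ solve 2 (λ a b → a :* a :* (b :* b) := (a :* b) :* (a :* b)) refl (suc r) (suc n) ⟩
    (suc r ℕ.* suc n) ℕ.* (suc r ℕ.* suc n)     ∎))))
  where
  open ℕ.≤-Reasoning
  open ℕSolver.+-*-Solver
  r = isqrt ν

-- `q` dominates `p ⊔ ε`, the number that `1/⊔` inverts.
1≤*-1/⊔ : ∀ ε 0<ε {p q} → p ℚ.≤ q → ε ℚ.≤ q → 1ℚ ℚ.≤ q ℚ.* 1/⊔ ε 0<ε p
1≤*-1/⊔ ε 0<ε {p} {q} p≤q ε≤q = subst (ℚ._≤ q ℚ.* 1/⊔ ε 0<ε p) (1/⊔-inverse ε 0<ε p)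
  (ℚ.*-monoʳ-≤-nonNeg (1/⊔ ε 0<ε p) {{ℚ.pos⇒nonNeg (1/⊔ ε 0<ε p) {{1/⊔-pos ε 0<ε p}}}} (ℚ.⊔-lub p≤q ε≤q))

-- The final estimate at a single index; here `ρ` is the reciprocal term of the theorem. Half of `ε`
-- absorbs the tolerance in the real inequality `x W ≤ M`, and the other half survives as the margin
-- that a strict inequality requires.
ratio-bound : ∀ {q ε x W M H H+4 ρ} → 0ℚ ℚ.< H → 0ℚ ℚ.< W → H+4 ≡ fromℕℚ 4 ℚ.+ H →
  q ℚ.+ ε ℚ.≤ x → x ℚ.* W ℚ.≤ M ℚ.+ ½ ℚ.* ε ℚ.* W →
  fromℕℚ 4 ℚ.* H ℚ.* M ℚ.≤ H+4 ℚ.* W → 1ℚ ℚ.≤ H ℚ.* ρ →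
  q ℚ.+ ½ ℚ.* ε ℚ.≤ + 1 ℚ./ 4 ℚ.+ ρ
ratio-bound {q} {ε} {x} {W} {M} {H} {_} {ρ} 0<H 0<W refl q+ε≤x xW≤ M≤ 1≤Hρ =
  ℚ.*-cancelˡ-≤-pos (4H ℚ.* W) {{ℚ.pos*pos⇒pos 4H {{4H>0}} W {{ℚ.positive 0<W}}}} (begin
    4H ℚ.* W ℚ.* (q ℚ.+ ½ε)
      ≡⟨ solve 4 (λ H W q e → con (fromℕℚ 4) :* H :* W :* (q :+ con ½ :* e)
           := con (fromℕℚ 4) :* H :* ((q :+ e) :* W) :- con (fromℕℚ 4) :* H :* (con ½ :* e :* W)) refl H W q ε ⟩
    4H ℚ.* ((q ℚ.+ ε) ℚ.* W) ℚ.- 4H ℚ.* (½ε ℚ.* W)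
      ≤⟨ ℚ.+-monoˡ-≤ (ℚ.- (4H ℚ.* (½ε ℚ.* W))) (ℚ.*-monoˡ-≤-nonNeg 4H {{ℚ.pos⇒nonNeg 4H {{4H>0}}}} (ℚ.≤-trans
           (ℚ.*-monoʳ-≤-nonNeg W {{W≥0}} q+ε≤x) xW≤)) ⟩
    4H ℚ.* (M ℚ.+ ½ε ℚ.* W) ℚ.- 4H ℚ.* (½ε ℚ.* W)
      ≡⟨ solve 3 (λ a m b → a :* (m :+ b) :- a :* b := a :* m) refl 4H M (½ε ℚ.* W) ⟩
    4H ℚ.* M
      ≤⟨ M≤ ⟩
    (fromℕℚ 4 ℚ.+ H) ℚ.* W
      ≡⟨ solve 2 (λ H W → (con (fromℕℚ 4) :+ H) :* W := H :* W :+ con (fromℕℚ 4) :* W :* con 1ℚ) refl H W ⟩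
    H ℚ.* W ℚ.+ fromℕℚ 4 ℚ.* W ℚ.* 1ℚ
      ≤⟨ ℚ.+-monoʳ-≤ (H ℚ.* W) (ℚ.*-monoˡ-≤-nonNeg (fromℕℚ 4 ℚ.* W)
           {{ℚ.nonNegative (0≤*0≤ (0≤fromℕℚ 4) (ℚ.<⇒≤ 0<W))}} 1≤Hρ) ⟩
    H ℚ.* W ℚ.+ fromℕℚ 4 ℚ.* W ℚ.* (H ℚ.* ρ)
      ≡⟨ solve 3 (λ H W p → H :* W :+ con (fromℕℚ 4) :* W :* (H :* p)
           := con (fromℕℚ 4) :* H :* W :* (con (+ 1 ℚ./ 4) :+ p)) refl H W ρ ⟩
    4H ℚ.* W ℚ.* (+ 1 ℚ./ 4 ℚ.+ ρ) ∎)
  where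
  open ℚ.≤-Reasoning
  open ℚSolver.+-*-Solver
  4H = fromℕℚ 4 ℚ.* H
  ½ε = ½ ℚ.* ε
  4H>0 : ℚ.Positive 4H
  4H>0 = ℚ.pos*pos⇒pos (fromℕℚ 4) H {{ℚ.positive 0<H}}
  W≥0 : ℚ.NonNegative W
  W≥0 = ℚ.nonNegative (ℚ.<⇒≤ 0<W)

3≤isqrt : ∀ {ν} → 12 ℕ.≤ ν → 3 ℕ.≤ isqrt ν
3≤isqrt {ν} 12≤ν = ℕ.≤-pred (square-cancel-< {3} {suc (isqrt ν)}
  (ℕ.≤-<-trans (ℕ.≤-trans (ℕ.m≤m+n 9 3) 12≤ν) (<[1+isqrt]² ν)))

mainTheorem13 : (ν : ℕ) (12≤ν : 12 ℕ.≤ ν) →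
    c ν ≤ᶜ ↓ (fromℚ (+ 1 ℚ./ 4) + recip (fromℕ 3 * √ ν - fromℕ 10) (0<3√ν-10 12≤ν))
mainTheorem13 ν 12≤ν q (x , (_ , admissible) , ε , 0<ε , N₁ , q+ε≤x) =
  -- Half of the margin by which `x` exceeds `q` remains as the margin below the bound.
  ½ ℚ.* ε , 0<½*p 0<ε , N₁ ℕ.⊔ N₂ , λ i N≤i →
    ratio-bound {q} {ε} {seq x i} {M = seq (mac (extremal e)) i} 0<h (0<fullWeight e) (fromℕℚ-+ 4 h)
      (q+ε≤x i (ℕ.m⊔n≤o⇒m≤o N₁ N₂ N≤i))
      (subst (λ w → seq x i ℚ.* w ℚ.≤ seq (mac (extremal e)) i ℚ.+ η) (seq-totalWeight n i)
        (x*w≤ i (ℕ.m⊔n≤o⇒n≤o N₁ N₂ N≤i)))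
      (mac-extremal-≤ e i)
      -- `1/5` is the positive lower bound chosen in `0<3√ν-10`, hence the truncation used by
      -- `recip`; it lies below `h`, which is at least 2.
      (1≤*-1/⊔ (+ 1 ℚ./ 5) (ℚ.positive⁻¹ _) (3√-10≤h i) (/-cross-≤ 1 4 h 0 (s≤s z≤n)))
  where
  t = isqrt ν ℕ.∸ 3
  e = ν ℕ.∸ isqrt ν ℕ.* isqrt ν

  open Ramp t

  n = flat e ℕ.+ L
  -- The tolerance is proportional to the total weight, so that dividing by that weight leaves
  -- `½ ε`.
  η = ½ ℚ.* ε ℚ.* fullWeight n

  r≡isqrt : r ≡ isqrt ν
  r≡isqrt = ℕ.m+[n∸m]≡n (3≤isqrt 12≤ν)

  n≡ν : n ≡ ν
  n≡ν = trans (sym (e+r²≡flat+L e)) (trans (cong (λ s → e ℕ.+ s ℕ.* s) r≡isqrt)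
    (ℕ.m∸n+n≡m (isqrt²≤ ν)))

  0<h : 0ℚ ℚ.< fromℕℚ h
  0<h = ℚ.positive⁻¹ (fromℕℚ h) {{fromℕℚ-suc-pos (1 ℕ.+ 3 ℕ.* t)}}

  0<η : 0ℚ ℚ.< η
  0<η = ℚ.positive⁻¹ η {{ℚ.pos*pos⇒pos (½ ℚ.* ε) {{ℚ.positive (0<½*p 0<ε)}}
    (fullWeight n) {{ℚ.positive (0<fullWeight e)}}}}

  -- Every approximation of `√ν` is at most `r + 1`, and `3(r + 1) - 10 = 3r - 7`. This rounding
  -- turns the 7 in `h` into the 10 of the theorem.
  3√-10≤h : ∀ i → fromℕℚ 3 ℚ.* √seq ν i ℚ.+ ℚ.- fromℕℚ 10 ℚ.≤ fromℕℚ h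
  3√-10≤h i = begin
    fromℕℚ 3 ℚ.* √seq ν i ℚ.+ ℚ.- fromℕℚ 10
      ≤⟨ ℚ.+-monoˡ-≤ (ℚ.- fromℕℚ 10) (ℚ.*-monoˡ-≤-nonNeg (fromℕℚ 3) (√seq-≤ ν i)) ⟩
    fromℕℚ 3 ℚ.* fromℕℚ (suc (isqrt ν)) ℚ.+ ℚ.- fromℕℚ 10
      ≡⟨ cong (ℚ._+ ℚ.- fromℕℚ 10) (fromℕℚ-* 3 (suc (isqrt ν))) ⟨
    fromℕℚ (3 ℕ.* suc (isqrt ν)) ℚ.+ ℚ.- fromℕℚ 10
      ≡⟨ cong (λ s → fromℕℚ (3 ℕ.* suc s) ℚ.+ ℚ.- fromℕℚ 10) r≡isqrt ⟨
    fromℕℚ (3 ℕ.* suc r) ℚ.+ ℚ.- fromℕℚ 10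
      ≡⟨ cong (λ s → fromℕℚ s ℚ.+ ℚ.- fromℕℚ 10) (ℕS.solve 1 (λ t → ℕS.con 3 ℕS.:* (ℕS.con 4 ℕS.:+ t)
           ℕS.:= (ℕS.con 2 ℕS.:+ ℕS.con 3 ℕS.:* t) ℕS.:+ ℕS.con 10) refl t) ⟩
    fromℕℚ (h ℕ.+ 10) ℚ.+ ℚ.- fromℕℚ 10
      ≡⟨ cong (ℚ._+ ℚ.- fromℕℚ 10) (fromℕℚ-+ h 10) ⟩
    fromℕℚ h ℚ.+ fromℕℚ 10 ℚ.+ ℚ.- fromℕℚ 10
      ≡⟨ solve 1 (λ h → h :+ con (fromℕℚ 10) :+ (:- con (fromℕℚ 10)) := h) refl (fromℕℚ h) ⟩
    fromℕℚ h ∎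
    where
    open ℚ.≤-Reasoning
    open ℚSolver.+-*-Solver
    module ℕS = ℕSolver.+-*-Solver

  bound = admissible (extremal e)
    (transitiveTournament-acyclic n (geometricWeight n) (0≤geometricWeight n))
    (subst (LongestPathOrder (extremal e)) n≡ν
      (transitiveTournament-longestPathOrder n (geometricWeight n) (0≤geometricWeight n))) η 0<η

  N₂ : ℕ
  N₂ = bound .proj₁

  x*w≤ : ∀ i → N₂ ℕ.≤ i → seq x i ℚ.* seq (totalWeight (extremal e)) i ℚ.≤ seq (mac (extremal e)) i ℚ.+ η
  x*w≤ = bound .proj₂
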